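{- Let $pds_{3D}(n)$ be the number of (non-oriented) $3D$ partially directed snakes of length $n$. Then, as formal power series, $$\sum_{n\ge 0} pds_{3D}(n)\,q^n=\frac{4q^5+2q^4+2q^2-3q+1}{(1-q)(1-3q-4q^3)}.$$ Moreover $pds_{3D}(0)=pds_{3D}(1)=1$ and for all $n\ge 2$ $$pds_{3D}(n)=\frac{1}{12}\sum_{\alpha:\,1-3\alpha-4\alpha^3=0}\left(\alpha^{ -1}+1\right)\alpha^{ -n}\;-\;1,$$ where the sum runs over the complex roots $\alpha$ of $1-3\alpha-4\alpha^3$.
   Context: Cells are the unit cubes of the lattice $\mathbb{Z}^3$ (axes $x,y,z$); two cells are adjacent if they share a face. A $3D$ polyomino is a finite face-connected set of cells, considered up to translation, viewed as a graph via face adjacency. A $3D$ snake of length $n$ is a $3D$ polyomino with $n$ cells, no cycle, and every cell of degree at most two (so its adjacency graph is a path). Snakes are non-oriented, i.e. counted as sets of cells up to translation (no rotations or reflections). A $3D$ snake is a $3D$ partially directed snake ($3D$ PDS) if its cells can be listed from one end of the path to the other so that each step is in one of the four directions $x^+,x^-,y^+,z^+$ (steps in the negative $y$ and $z$ directions are forbidden). By convention the empty snake is the unique $3D$ PDS of length $0$. -}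

module Defs where

open import Data.Fin using (Fin; toℕ)
open import Data.Integer as ℤ using (ℤ; +_; -[1+_]; 0ℤ; 1ℤ)
import Data.Integer.Properties as ℤ
open import Data.Integer.Tactic.RingSolver using (solve-∀)
open import Data.List using (List; []; _∷_; [_]; _++_; length; map; filter)
import Data.List.Properties as List
open import Data.List.Membership.Propositional using (_∈_)
open import Data.List.Relation.Binary.BagAndSetEquality using (_∼[_]_; set; [_]-Equality; map-cong)
open import Data.List.Relation.Binary.Permutation.Propositional using (_↭_)
open import Data.List.Relation.Unary.All using (All)
open import Data.List.Relation.Unary.Linked using (Linked)
open import Data.List.Relation.Unary.Unique.Propositional using (Unique)
open import Data.Nat as ℕ using (ℕ; zero; suc; _∸_)
import Data.Nat.Properties as ℕ
open import Data.Product using (∃; ∃-syntax; _×_; _,_; proj₁)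
open import Data.Rational as ℚ using (ℚ; 0ℚ; 1ℚ; ½)
import Data.Rational.Properties as ℚ
open import Data.Rational.Solver using (module +-*-Solver)
open import Data.Vec.Functional using (foldr)
open import Function.Bundles using (Bijection)
open import Level using (0ℓ)
open import Relation.Binary.Bundles using (Setoid)
open import Relation.Binary.Construct.Closure.ReflexiveTransitive using (Star)
open import Relation.Binary.PropositionalEquality
  using (_≡_; _≗_; refl; sym; trans; cong; subst; setoid)
open import Relation.Nullary using (¬_; Dec)

Enumeration : ℕ → Setoid 0ℓ 0ℓ → Set
Enumeration n S = Bijection (setoid (Fin n)) S

------------------------------------------------------------------------
-- Snakes

Cell : Set
Cell = ℤ × ℤ × ℤ

infixl 6 _⊕_

_⊕_ : Cell → Cell → Cell
(x , y , z) ⊕ (x′ , y′ , z′) = x ℤ.+ x′ , y ℤ.+ y′ , z ℤ.+ z′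

-- Two unit cubes share a face iff their positions are at ℓ¹-distance 1.
Adjacent : Cell → Cell → Set
Adjacent (x , y , z) (x′ , y′ , z′) =
  ℤ.∣ x ℤ.- x′ ∣ ℕ.+ ℤ.∣ y ℤ.- y′ ∣ ℕ.+ ℤ.∣ z ℤ.- z′ ∣ ≡ 1

adjacent? : ∀ c d → Dec (Adjacent c d)
adjacent? _ _ = _ ℕ.≟ 1

-- Finite sets of cells are lists of cells without repetition, considered up to
-- _∼[ set ]_ (having the same members).

Connected : List Cell → Set
Connected P = ∀ {a b} → a ∈ P → b ∈ P → Star (λ c d → Adjacent c d × d ∈ P) a b

-- The cycle visits c, then the cells of cs in order, and returns to c.
record Cycle (P : List Cell) : Set where
  field
    c        : Cell
    cs       : List Cell
    cells⊆P  : All (_∈ P) (c ∷ cs)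
    distinct : Unique (c ∷ cs)
    length≥3 : 3 ℕ.≤ length (c ∷ cs)
    closed   : Linked Adjacent (c ∷ cs ++ [ c ])

degree : List Cell → Cell → ℕ
degree P c = length (filter (adjacent? c) P)

record IsSnake (P : List Cell) : Set where
  field
    unique    : Unique P
    connected : Connected P
    acyclic   : ¬ Cycle P
    degree≤2  : ∀ {c} → c ∈ P → degree P c ℕ.≤ 2

data Direction : Set where
  x⁺ x⁻ y⁺ z⁺ : Direction

unitVector : Direction → Cell
unitVector x⁺ = 1ℤ , 0ℤ , 0ℤ
unitVector x⁻ = ℤ.-1ℤ , 0ℤ , 0ℤ
unitVector y⁺ = 0ℤ , 1ℤ , 0ℤ
unitVector z⁺ = 0ℤ , 0ℤ , 1ℤ

Step : Cell → Cell → Set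
Step c d = ∃[ s ] d ≡ c ⊕ unitVector s

-- Steps join adjacent cells, so a listing of all the cells by steps runs along
-- the path from one of its ends to the other.
PartiallyDirected : List Cell → Set
PartiallyDirected P = ∃[ w ] w ↭ P × Linked Step w

record PDS (n : ℕ) : Set where
  field
    cells             : List Cell
    isSnake           : IsSnake cells
    partiallyDirected : PartiallyDirected cells
    length≡n          : length cells ≡ n

infix 4 _≃_

_≃_ : List Cell → List Cell → Set
P ≃ Q = ∃[ t ] map (t ⊕_) P ∼[ set ] Q

private
  module S = Setoid ([ set ]-Equality Cell)

  triple : ∀ {x y z x′ y′ z′ : ℤ} → x ≡ x′ → y ≡ y′ → z ≡ z′ →
           _≡_ {A = Cell} (x , y , z) (x′ , y′ , z′)
  triple refl refl refl = refl

neg : Cell → Cell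
neg (x , y , z) = ℤ.- x , ℤ.- y , ℤ.- z

origin : Cell
origin = 0ℤ , 0ℤ , 0ℤ

⊕-identityˡ : ∀ c → origin ⊕ c ≡ c
⊕-identityˡ (x , y , z) = triple (ℤ.+-identityˡ x) (ℤ.+-identityˡ y) (ℤ.+-identityˡ z)

⊕-assoc : ∀ a b c → a ⊕ b ⊕ c ≡ a ⊕ (b ⊕ c)
⊕-assoc (x , y , z) (x′ , y′ , z′) (x″ , y″ , z″) =
  triple (ℤ.+-assoc x x′ x″) (ℤ.+-assoc y y′ y″) (ℤ.+-assoc z z′ z″)

neg-inverseˡ : ∀ c → neg c ⊕ c ≡ origin
neg-inverseˡ (x , y , z) = triple (ℤ.+-inverseˡ x) (ℤ.+-inverseˡ y) (ℤ.+-inverseˡ z)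

translate-∘ : ∀ s t P → map (s ⊕_) (map (t ⊕_) P) ≡ map (s ⊕ t ⊕_) P
translate-∘ s t P =
  trans (sym (List.map-∘ P)) (List.map-cong (λ c → sym (⊕-assoc s t c)) P)

translate-origin : ∀ P → map (origin ⊕_) P ≡ P
translate-origin P = trans (List.map-cong ⊕-identityˡ P) (List.map-id P)

translate-cong : ∀ t {P Q} → P ∼[ set ] Q → map (t ⊕_) P ∼[ set ] map (t ⊕_) Q
translate-cong t = map-cong (λ _ → refl)

≃-refl : ∀ {P} → P ≃ P
≃-refl {P} = origin , S.reflexive (translate-origin P)

≃-sym : ∀ {P Q} → P ≃ Q → Q ≃ P
≃-sym {P} (t , tP∼Q) = neg t , S.trans (translate-cong (neg t) (S.sym tP∼Q))
  (S.reflexive (trans (translate-∘ (neg t) t P)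
    (trans (cong (λ u → map (u ⊕_) P) (neg-inverseˡ t)) (translate-origin P))))

≃-trans : ∀ {P Q R} → P ≃ Q → Q ≃ R → P ≃ R
≃-trans {P} (t , tP∼Q) (s , sQ∼R) = s ⊕ t ,
  S.trans (S.reflexive (sym (translate-∘ s t P))) (S.trans (translate-cong s tP∼Q) sQ∼R)

PDS-setoid : ℕ → Setoid 0ℓ 0ℓ
PDS-setoid n = record
  { Carrier       = PDS n
  ; _≈_           = λ P Q → PDS.cells P ≃ PDS.cells Q
  ; isEquivalence = record { refl = ≃-refl ; sym = ≃-sym ; trans = ≃-trans }
  }

------------------------------------------------------------------------
-- Formal power series over ℤ

Series : Set
Series = ℕ → ℤ

infixl 7 _⊛_ _⊘_

_⊛_ : Series → Series → Series
(a ⊛ b) n = foldr ℤ._+_ 0ℤ {suc n} λ k → a (toℕ k) ℤ.* b (n ∸ toℕ k)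

-- Quotient of a by a series b with constant term 1, by long division;
-- characterised by ⊘-⊛ below.
_⊘_ : Series → Series → Series
(a ⊘ b) zero    = a 0
(a ⊘ b) (suc n) = ((λ k → a (suc k) ℤ.- a 0 ℤ.* b (suc k)) ⊘ b) n

⊘-⊛ : ∀ a b → b 0 ≡ 1ℤ → a ⊘ b ⊛ b ≗ a
⊘-⊛ a b b₀≡1 zero = trans (ℤ.+-identityʳ _)
  (trans (cong (a 0 ℤ.*_) b₀≡1) (ℤ.*-identityʳ (a 0)))
⊘-⊛ a b b₀≡1 (suc n) = trans
  (cong (λ u → a 0 ℤ.* b (suc n) ℤ.+ u) (⊘-⊛ (λ k → a (suc k) ℤ.- a 0 ℤ.* b (suc k)) b b₀≡1 n))
  (cancel (a 0 ℤ.* b (suc n)) (a (suc n)))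
  where
  cancel : ∀ u v → u ℤ.+ (v ℤ.- u) ≡ v
  cancel = solve-∀

-- Coefficients are listed from the constant term upwards.
polynomial : List ℤ → Series
polynomial []       _       = 0ℤ
polynomial (a ∷ as) zero    = a
polynomial (a ∷ as) (suc n) = polynomial as n

------------------------------------------------------------------------
-- Real numbers, as Cauchy sequences of rationals

EventuallyWithin : ℚ → (ℕ → ℚ) → Set
EventuallyWithin ε a = ∃[ N ] ∀ n → N ℕ.≤ n → ℚ.∣ a n ∣ ℚ.< ε

Cauchy : (ℕ → ℚ) → Set
Cauchy a = ∀ ε → 0ℚ ℚ.< ε →
           ∃[ N ] ∀ m n → N ℕ.≤ m → N ℕ.≤ n → ℚ.∣ a m ℚ.- a n ∣ ℚ.< ε

record ℝ : Set where
  constructor mkℝ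
  field
    approx : ℕ → ℚ
    cauchy : Cauchy approx

open ℝ

infix 4 _≈ʳ_

_≈ʳ_ : ℝ → ℝ → Set
x ≈ʳ y = ∀ ε → 0ℚ ℚ.< ε → EventuallyWithin ε (λ n → approx x n ℚ.- approx y n)

private
  open ℚ.≤-Reasoning
  open +-*-Solver using (solve; _:=_; _:+_; _:*_; _:-_; :-_; con)

half>0 : ∀ {ε} → 0ℚ ℚ.< ε → 0ℚ ℚ.< ½ ℚ.* ε
half>0 {ε} 0<ε = subst (ℚ._< ½ ℚ.* ε) (ℚ.*-zeroʳ ½) (ℚ.*-monoʳ-<-pos ½ 0<ε)

halves : ∀ ε → ½ ℚ.* ε ℚ.+ ½ ℚ.* ε ≡ ε
halves = solve 1 (λ e → con ½ :* e :+ con ½ :* e := e) refl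

*-difference : ∀ p q r s → p ℚ.* r ℚ.- q ℚ.* s ≡ p ℚ.* (r ℚ.- s) ℚ.+ s ℚ.* (p ℚ.- q)
*-difference = solve 4 (λ p q r s → p :* r :- q :* s := p :* (r :- s) :+ s :* (p :- q)) refl

+-difference : ∀ p q r s → (p ℚ.+ r) ℚ.- (q ℚ.+ s) ≡ (p ℚ.- q) ℚ.+ (r ℚ.- s)
+-difference = solve 4 (λ p q r s → (p :+ r) :- (q :+ s) := (p :- q) :+ (r :- s)) refl

neg-difference : ∀ p q → q ℚ.- p ≡ ℚ.- p ℚ.- ℚ.- q
neg-difference = solve 2 (λ p q → q :- p := :- p :- :- q) refl

split-difference : ∀ p q r → p ℚ.- r ≡ (p ℚ.- q) ℚ.+ (q ℚ.- r)
split-difference = solve 3 (λ p q r → p :- r := (p :- q) :+ (q :- r)) refl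

add-difference : ∀ p q → p ≡ q ℚ.+ (p ℚ.- q)
add-difference = solve 2 (λ p q → p := q :+ (p :- q)) refl

within-+ : ∀ {ε} a b {c} → c ≡ a ℚ.+ b →
           ℚ.∣ a ∣ ℚ.< ½ ℚ.* ε → ℚ.∣ b ∣ ℚ.< ½ ℚ.* ε → ℚ.∣ c ∣ ℚ.< ε
within-+ {ε} a b refl a< b< = begin-strict
  ℚ.∣ a ℚ.+ b ∣            ≤⟨ ℚ.∣p+q∣≤∣p∣+∣q∣ a b ⟩
  ℚ.∣ a ∣ ℚ.+ ℚ.∣ b ∣      <⟨ ℚ.+-mono-< a< b< ⟩
  ½ ℚ.* ε ℚ.+ ½ ℚ.* ε      ≡⟨ halves ε ⟩
  ε                        ∎

abs-flip : ∀ p q → ℚ.∣ p ℚ.- q ∣ ≡ ℚ.∣ q ℚ.- p ∣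
abs-flip p q = trans
  (cong ℚ.∣_∣ (solve 2 (λ p q → p :- q := :- (q :- p)) refl p q))
  (ℚ.∣-p∣≡∣p∣ (q ℚ.- p))

-- A factor bounded by B and a factor within tolerance ε B have a product within ½ε.
tolerance : ℚ → (B : ℚ) → ℚ.Positive B → ℚ
tolerance ε B B>0 = (ℚ.1/ B) {{ℚ.pos⇒nonZero B {{B>0}}}} ℚ.* (½ ℚ.* ε)

tolerance>0 : ∀ {ε} B (B>0 : ℚ.Positive B) → 0ℚ ℚ.< ε → 0ℚ ℚ.< tolerance ε B B>0
tolerance>0 {ε} B B>0 0<ε = subst (ℚ._< 1/B ℚ.* (½ ℚ.* ε)) (ℚ.*-zeroʳ 1/B)
  (ℚ.*-monoʳ-<-pos 1/B {{ℚ.1/pos⇒pos B {{B>0}}}} (half>0 0<ε))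
  where 1/B = (ℚ.1/ B) {{ℚ.pos⇒nonZero B {{B>0}}}}

within-* : ∀ {ε} B (B>0 : ℚ.Positive B) a b →
           ℚ.∣ a ∣ ℚ.< B → ℚ.∣ b ∣ ℚ.< tolerance ε B B>0 → ℚ.∣ a ℚ.* b ∣ ℚ.< ½ ℚ.* ε
within-* {ε} B B>0 a b a< b< = begin-strict
  ℚ.∣ a ℚ.* b ∣                ≡⟨ ℚ.∣p*q∣≡∣p∣*∣q∣ a b ⟩
  ℚ.∣ a ∣ ℚ.* ℚ.∣ b ∣          ≤⟨ ℚ.*-monoʳ-≤-nonNeg ℚ.∣ b ∣ {{ℚ.∣-∣-nonNeg b}} (ℚ.<⇒≤ a<) ⟩
  B ℚ.* ℚ.∣ b ∣                <⟨ ℚ.*-monoʳ-<-pos B {{B>0}} b< ⟩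
  B ℚ.* (1/B ℚ.* (½ ℚ.* ε))    ≡⟨ ℚ.*-assoc B 1/B (½ ℚ.* ε) ⟨
  B ℚ.* 1/B ℚ.* (½ ℚ.* ε)      ≡⟨ cong (ℚ._* (½ ℚ.* ε)) (ℚ.*-inverseʳ B {{ℚ.pos⇒nonZero B {{B>0}}}}) ⟩
  1ℚ ℚ.* (½ ℚ.* ε)             ≡⟨ ℚ.*-identityˡ (½ ℚ.* ε) ⟩
  ½ ℚ.* ε                      ∎
  where 1/B = (ℚ.1/ B) {{ℚ.pos⇒nonZero B {{B>0}}}}

products-close : ∀ ε B (B>0 : ℚ.Positive B) C (C>0 : ℚ.Positive C) p q r s →
                 ℚ.∣ p ∣ ℚ.< B → ℚ.∣ s ∣ ℚ.< C →
                 ℚ.∣ r ℚ.- s ∣ ℚ.< tolerance ε B B>0 →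
                 ℚ.∣ p ℚ.- q ∣ ℚ.< tolerance ε C C>0 →
                 ℚ.∣ p ℚ.* r ℚ.- q ℚ.* s ∣ ℚ.< ε
products-close ε B B>0 C C>0 p q r s p< s< r-s p-q =
  within-+ {ε} (p ℚ.* (r ℚ.- s)) (s ℚ.* (p ℚ.- q)) (*-difference p q r s)
    (within-* {ε} B B>0 p (r ℚ.- s) p< r-s)
    (within-* {ε} C C>0 s (p ℚ.- q) s< p-q)

bounded : ∀ x → ∃[ B ] ℚ.Positive B × EventuallyWithin B (approx x)
bounded x with cauchy x 1ℚ (ℚ.positive⁻¹ 1ℚ)
... | N , close = B , pos , N , λ n N≤n → begin-strict
    ℚ.∣ approx x n ∣
      ≡⟨ cong ℚ.∣_∣ (add-difference (approx x n) xN) ⟩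
    ℚ.∣ xN ℚ.+ (approx x n ℚ.- xN) ∣
      ≤⟨ ℚ.∣p+q∣≤∣p∣+∣q∣ xN (approx x n ℚ.- xN) ⟩
    ℚ.∣ xN ∣ ℚ.+ ℚ.∣ approx x n ℚ.- xN ∣
      <⟨ ℚ.+-monoʳ-< ℚ.∣ xN ∣ (close n N N≤n ℕ.≤-refl) ⟩
    B ∎
  where
  xN = approx x N
  B = ℚ.∣ xN ∣ ℚ.+ 1ℚ
  pos : ℚ.Positive B
  pos = ℚ.positive (ℚ.+-mono-≤-< (ℚ.0≤∣p∣ xN) (ℚ.positive⁻¹ 1ℚ))

≈ʳ-refl : ∀ {x} → x ≈ʳ x
≈ʳ-refl {x} ε 0<ε = 0 , λ n _ →
  subst (λ u → ℚ.∣ u ∣ ℚ.< ε) (sym (ℚ.+-inverseʳ (approx x n))) 0<ε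

≈ʳ-sym : ∀ {x y} → x ≈ʳ y → y ≈ʳ x
≈ʳ-sym {x} {y} x≈y ε 0<ε with x≈y ε 0<ε
... | N , close = N , λ n N≤n →
  subst (ℚ._< ε) (abs-flip (approx x n) (approx y n)) (close n N≤n)

≈ʳ-trans : ∀ {x y z} → x ≈ʳ y → y ≈ʳ z → x ≈ʳ z
≈ʳ-trans {x} {y} {z} x≈y y≈z ε 0<ε with x≈y _ (half>0 0<ε) | y≈z _ (half>0 0<ε)
... | M , closeM | N , closeN = M ℕ.⊔ N , λ n M⊔N≤n →
  within-+ (approx x n ℚ.- approx y n) (approx y n ℚ.- approx z n)
    (split-difference (approx x n) (approx y n) (approx z n))
    (closeM n (ℕ.m⊔n≤o⇒m≤o M N M⊔N≤n)) (closeN n (ℕ.m⊔n≤o⇒n≤o M N M⊔N≤n))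

infixl 6 _+ʳ_ _-ʳ_
infixl 7 _*ʳ_
infix  8 -ʳ_

fromℚʳ : ℚ → ℝ
fromℚʳ q = mkℝ (λ _ → q) λ ε 0<ε → 0 , λ _ _ _ _ →
  subst (λ u → ℚ.∣ u ∣ ℚ.< ε) (sym (ℚ.+-inverseʳ q)) 0<ε

_+ʳ_ : ℝ → ℝ → ℝ
x +ʳ y = mkℝ (λ n → approx x n ℚ.+ approx y n) cauchy-+
  where
  cauchy-+ : Cauchy (λ n → approx x n ℚ.+ approx y n)
  cauchy-+ ε 0<ε with cauchy x _ (half>0 0<ε) | cauchy y _ (half>0 0<ε)
  ... | M , closeM | N , closeN = M ℕ.⊔ N , λ m n m≥ n≥ →
    within-+ (approx x m ℚ.- approx x n) (approx y m ℚ.- approx y n)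
      (+-difference (approx x m) (approx x n) (approx y m) (approx y n))
      (closeM m n (ℕ.m⊔n≤o⇒m≤o M N m≥) (ℕ.m⊔n≤o⇒m≤o M N n≥))
      (closeN m n (ℕ.m⊔n≤o⇒n≤o M N m≥) (ℕ.m⊔n≤o⇒n≤o M N n≥))

-ʳ_ : ℝ → ℝ
-ʳ x = mkℝ (λ n → ℚ.- approx x n) cauchy-neg
  where
  cauchy-neg : Cauchy (λ n → ℚ.- approx x n)
  cauchy-neg ε 0<ε with cauchy x ε 0<ε
  ... | N , close = N , λ m n m≥ n≥ →
    subst (λ u → ℚ.∣ u ∣ ℚ.< ε)
      (neg-difference (approx x m) (approx x n))
      (close n m n≥ m≥)

_-ʳ_ : ℝ → ℝ → ℝ
x -ʳ y = x +ʳ -ʳ y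

_*ʳ_ : ℝ → ℝ → ℝ
x *ʳ y = mkℝ (λ n → approx x n ℚ.* approx y n) cauchy-*
  where
  cauchy-* : Cauchy (λ n → approx x n ℚ.* approx y n)
  cauchy-* ε 0<ε =
    let B , B>0 , K , x<  = bounded x
        C , C>0 , L , y<  = bounded y
        M , closeM = cauchy y (tolerance ε B B>0) (tolerance>0 B B>0 0<ε)
        N , closeN = cauchy x (tolerance ε C C>0) (tolerance>0 C C>0 0<ε)
    in (K ℕ.⊔ L) ℕ.⊔ (M ℕ.⊔ N) , λ m n m≥ n≥ →
    let m≥K⊔L = ℕ.m⊔n≤o⇒m≤o (K ℕ.⊔ L) (M ℕ.⊔ N) m≥
        m≥M⊔N = ℕ.m⊔n≤o⇒n≤o (K ℕ.⊔ L) (M ℕ.⊔ N) m≥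
        n≥K⊔L = ℕ.m⊔n≤o⇒m≤o (K ℕ.⊔ L) (M ℕ.⊔ N) n≥
        n≥M⊔N = ℕ.m⊔n≤o⇒n≤o (K ℕ.⊔ L) (M ℕ.⊔ N) n≥
    in products-close ε B B>0 C C>0 (approx x m) (approx x n) (approx y m) (approx y n)
      (x< m (ℕ.m⊔n≤o⇒m≤o K L m≥K⊔L))
      (y< n (ℕ.m⊔n≤o⇒n≤o K L n≥K⊔L))
      (closeM m n (ℕ.m⊔n≤o⇒m≤o M N m≥M⊔N) (ℕ.m⊔n≤o⇒m≤o M N n≥M⊔N))
      (closeN m n (ℕ.m⊔n≤o⇒n≤o M N m≥M⊔N) (ℕ.m⊔n≤o⇒n≤o M N n≥M⊔N))

------------------------------------------------------------------------
-- Complex numbers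

record ℂ : Set where
  constructor _+i_
  field
    re im : ℝ

open ℂ

infix  4 _≈_
infixl 6 _+_ _-_
infixl 7 _*_
infixr 8 _^_

_≈_ : ℂ → ℂ → Set
z ≈ w = re z ≈ʳ re w × im z ≈ʳ im w

fromℚ : ℚ → ℂ
fromℚ q = fromℚʳ q +i fromℚʳ 0ℚ

fromℕ : ℕ → ℂ
fromℕ n = fromℚ (+ n ℚ./ 1)

_+_ _-_ _*_ : ℂ → ℂ → ℂ
z + w = (re z +ʳ re w) +i (im z +ʳ im w)
z - w = (re z -ʳ re w) +i (im z -ʳ im w)
z * w = (re z *ʳ re w -ʳ im z *ʳ im w) +i (re z *ʳ im w +ʳ im z *ʳ re w)

_^_ : ℂ → ℕ → ℂ
z ^ zero  = fromℕ 1
z ^ suc n = z * z ^ n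

∑ : ∀ {m} → (Fin m → ℂ) → ℂ
∑ = foldr _+_ (fromℕ 0)

IsRoot : ℂ → Set
IsRoot α = fromℕ 1 - fromℕ 3 * α - fromℕ 4 * α ^ 3 ≈ fromℕ 0

Root-setoid : Setoid 0ℓ 0ℓ
Root-setoid = record
  { Carrier       = ∃ IsRoot
  ; _≈_           = λ α β → proj₁ α ≈ proj₁ β
  ; isEquivalence = record
    { refl  = λ { {α} → ≈ʳ-refl {re (proj₁ α)} , ≈ʳ-refl {im (proj₁ α)} }
    ; sym   = λ { {α} {β} (p , q) →
        ≈ʳ-sym {re (proj₁ α)} {re (proj₁ β)} p , ≈ʳ-sym {im (proj₁ α)} {im (proj₁ β)} q }
    ; trans = λ { {α} {β} {γ} (p , q) (p′ , q′) →
        ≈ʳ-trans {re (proj₁ α)} {re (proj₁ β)} {re (proj₁ γ)} p p′ ,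
        ≈ʳ-trans {im (proj₁ α)} {im (proj₁ β)} {im (proj₁ γ)} q q′ }
    }
  }

{-# OPTIONS --safe #-}
module Submission where

-- A partially directed walk is a snake iff its word contains neither x⁺x⁻ nor
-- x⁺ux⁻ (nor the mirror images) for u = y⁺, z⁺, since cells whose levels y + z
-- differ by two or more are not adjacent.  Words of length n avoiding these
-- patterns are counted by a three-state automaton, whence
-- f (n + 3) = 3 f (n + 2) + 4 f n.  The ends of a snake are its cells with at
-- most one neighbour, so the set of cells determines the word up to reversal,
-- and reversal gives a second word only for powers of x⁺ and x⁻.  Hence there
-- are f (n - 1) - 1 snakes of length n ≥ 2.
--
-- The inverses β of the roots satisfy β³ = 3β² + 4, with Σ β = 3 and Σ β² = 9,
-- so Σ (β + 1) βⁿ obeys the recurrence of f and equals 12 f (n - 1) for n ≥ 1.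
-- The real root ρ is the limit of a contraction, and the other two are
-- -ρ/2 ± iν, where ν = √(3/2) (1/2 + ρ/2 + ρ²) because the discriminant of the
-- cubic is -6·12².  Every root is one of these three since its imaginary part
-- is apart from two of 0, ν and -ν.

open import Defs hiding (_+_; _*_; _-_; _≈_; _^_; ∑)
open import Algebra.Bundles using (CommutativeRing)
import Algebra.Properties.AbelianGroup as AbelianGroup
import Algebra.Properties.Group as Group
import Algebra.Solver.Ring
open import Algebra.Solver.Ring.AlmostCommutativeRing using (fromCommutativeRing; _-Raw-AlmostCommutative⟶_)
open import Data.Empty using (⊥-elim)
open import Data.Fin using (Fin; zero; suc)
open import Data.Integer as ℤ using (ℤ; +_; -[1+_]; 0ℤ; 1ℤ; _◃_)
import Data.Integer.Properties as ℤ
open import Data.Integer.Tactic.RingSolver using (solve-∀)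
open import Data.List using (List; []; _∷_; [_]; _++_; length; map; concatMap; replicate; lookup)
import Data.List.Properties as List
open import Data.List.Membership.Propositional using (_∈_; _∉_)
open import Data.List.Membership.Propositional.Properties
  using (∈-map⁺; ∈-map⁻; ∈-++⁺ˡ; ∈-++⁺ʳ; ∈-++⁻; ∈-lookup)
open import Data.List.Relation.Binary.BagAndSetEquality using (_∼[_]_; set; [_]-Equality)
open import Data.List.Relation.Binary.Permutation.Propositional
  using (_↭_; ↭-refl; ↭-sym; ↭-trans; ↭-reflexive; prep; ↭⇒↭ₛ)
open import Data.List.Relation.Binary.Permutation.Propositional.Properties using (∈-resp-↭; ↭-length; ++-comm)
import Data.List.Relation.Binary.Permutation.Setoid.Properties as ↭ₛ
open import Data.List.Relation.Unary.All as All using (All; []; _∷_)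
open import Data.List.Relation.Unary.AllPairs using ([]; _∷_)
open import Data.List.Relation.Unary.Any as Any using (here; there; any?)
import Data.List.Relation.Unary.Any.Properties as Any
open import Data.List.Relation.Unary.Linked using (Linked; []; [-]; _∷_)
open import Data.List.Relation.Unary.Unique.Propositional using (Unique)
import Data.List.Relation.Unary.Unique.Propositional.Properties as Unique
open import Data.Maybe using (just; nothing)
open import Data.Nat as ℕ using (ℕ; zero; suc; _≤_; z≤n; s≤s)
import Data.Nat.ListAction as ℕ
import Data.Nat.Properties as ℕ
import Data.Nat.Solver as ℕSolver
open import Data.Product using (∃; ∃-syntax; Σ-syntax; _×_; _,_; proj₁; proj₂)
open import Data.Product.Properties using (≡-dec)
open import Data.Rational as ℚ using (ℚ; 0ℚ; 1ℚ; ½; _/_; mkℚ)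
import Data.Rational.Properties as ℚ
open import Data.Rational.Unnormalised as ℚᵘ using (mkℚᵘ; *<*; *≡*)
import Data.Rational.Unnormalised.Properties as ℚᵘ
open import Data.Sign as Sign using (Sign)
import Data.Sign.Properties as Sign
open import Data.Sum using (_⊎_; inj₁; inj₂)
open import Function using (_∘_)
open import Function.Bundles using (module Bijection; module Equivalence; mk⇔)
open import Level using (0ℓ)
open import Relation.Binary.Bundles using (Setoid)
open import Relation.Binary.Construct.Closure.ReflexiveTransitive as Star using (_◅_; _◅◅_)
open import Relation.Binary.Definitions using (WeaklyDecidable)
open import Relation.Binary.PropositionalEquality as ≡
  using (_≡_; _≢_; _≗_; refl; sym; trans; cong; cong₂; subst; module ≡-Reasoning)
open import Relation.Nullary using (¬_; Dec; yes; no)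

-- Power series

-- Equality of complex numbers is undecidable here, and a vanishing product does not reveal which of
-- its factors vanishes. This shapes the analytic half. For a root z two of the three linear factors
-- must be bounded away from zero, and which two must be read off from one rational approximation of
-- im z. It also decides how the roots are built. Dividing the cubic by z - ρ leaves ν² = 3/4 (ρ² +
-- 1), whose direct solution is the square root of a real number. Instead, (4ρ² + 1)² (ρ² + 1) =
-- (4ρ³ + 3ρ)² + 1 = 2, so ν = √(3/2) / (4ρ² + 1), and 4ρ³ + 3ρ = 1 turns 1 / (4ρ² + 1) into the
-- polynomial 1/2 + ρ/2 + ρ². Thus two iterations of rational polynomials suffice. Both stay in
-- [0, 1/2], so the sign and size estimates hold at every index and not only in the limit.

⊘-unique : ∀ s a b → b 0 ≡ 1ℤ → s ⊛ b ≗ a → s ≗ a ⊘ b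
⊘-unique s a b b₀≡1 s⊛b≗a zero = trans (sym s⊛b₀≡s₀) (s⊛b≗a 0)
  where
  s⊛b₀≡s₀ : (s ⊛ b) 0 ≡ s 0
  s⊛b₀≡s₀ = trans (ℤ.+-identityʳ _) (trans (cong (s 0 ℤ.*_) b₀≡1) (ℤ.*-identityʳ (s 0)))
⊘-unique s a b b₀≡1 s⊛b≗a (suc n) = ⊘-unique (s ∘ suc) _ b b₀≡1 tails n
  where
  cancel : ∀ u v → v ≡ u ℤ.+ v ℤ.- u
  cancel = solve-∀
  -- Once s 0 ≡ a 0 is known, subtracting s 0 times b leaves the same equation for the tail, with
  -- the numerator of the next step of long division.
  tails : s ∘ suc ⊛ b ≗ λ k → a (suc k) ℤ.- a 0 ℤ.* b (suc k)
  tails k = trans (cancel (s 0 ℤ.* b (suc k)) _)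
    (cong₂ (λ u v → u ℤ.- v ℤ.* b (suc k)) (s⊛b≗a (suc k)) (⊘-unique s a b b₀≡1 s⊛b≗a 0))

⊛-congʳ : ∀ s {b c} → b ≗ c → s ⊛ b ≗ s ⊛ c
⊛-congʳ s b≗c zero    = cong (λ u → s 0 ℤ.* u ℤ.+ 0ℤ) (b≗c 0)
⊛-congʳ s b≗c (suc n) =
  cong₂ (λ u v → s 0 ℤ.* u ℤ.+ v) (b≗c (suc n)) (⊛-congʳ (s ∘ suc) b≗c n)

polynomial[]-⊛ : ∀ b n → (polynomial [] ⊛ b) n ≡ 0ℤ
polynomial[]-⊛ b zero    = refl
polynomial[]-⊛ b (suc n) = trans (ℤ.+-identityˡ _) (polynomial[]-⊛ b n)

denominator : Series
denominator = polynomial (+ 1 ∷ -[1+ 0 ] ∷ []) ⊛ polynomial (+ 1 ∷ -[1+ 2 ] ∷ + 0 ∷ -[1+ 3 ] ∷ [])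

denominator-expanded :
  denominator ≗ polynomial (+ 1 ∷ -[1+ 3 ] ∷ + 3 ∷ -[1+ 3 ] ∷ + 4 ∷ [])
denominator-expanded 0 = refl
denominator-expanded 1 = refl
denominator-expanded 2 = refl
denominator-expanded 3 = refl
denominator-expanded 4 = refl
denominator-expanded (suc (suc (suc (suc (suc n))))) =
  trans (ℤ.+-identityˡ _) (trans (ℤ.+-identityˡ _)
    (polynomial[]-⊛ (polynomial (+ 1 ∷ -[1+ 2 ] ∷ + 0 ∷ -[1+ 3 ] ∷ [])) (suc (suc (suc n)))))

-- By uniqueness of quotients it suffices to multiply out. The numerator has degree five, so six
-- coefficients are checked by hand; from degree six on the recurrence says that the coefficient
-- vanishes.
quotient-by-denominator : ∀ s → s 0 ≡ + 1 → s 1 ≡ + 1 → s 2 ≡ + 3 → s 3 ≡ + 13 → s 4 ≡ + 45 → s 5 ≡ + 153 →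
  (∀ n → s (6 ℕ.+ n) ≡ + 4 ℤ.* s (5 ℕ.+ n) ℤ.- + 3 ℤ.* s (4 ℕ.+ n) ℤ.+ + 4 ℤ.* s (3 ℕ.+ n) ℤ.- + 4 ℤ.* s (2 ℕ.+ n)) →
  s ≗ polynomial (+ 1 ∷ -[1+ 2 ] ∷ + 2 ∷ + 0 ∷ + 2 ∷ + 4 ∷ []) ⊘ denominator
quotient-by-denominator s s₀ s₁ s₂ s₃ s₄ s₅ rec =
  ⊘-unique s _ denominator refl λ n → trans (⊛-congʳ s denominator-expanded n) (product n)
  where
  D = polynomial (+ 1 ∷ -[1+ 3 ] ∷ + 3 ∷ -[1+ 3 ] ∷ + 4 ∷ [])
  N = polynomial (+ 1 ∷ -[1+ 2 ] ∷ + 2 ∷ + 0 ∷ + 2 ∷ + 4 ∷ [])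
  -- `D` has degree four, so t 0 does not reach this coefficient.
  drop : ∀ t n → (t ⊛ D) (5 ℕ.+ n) ≡ (t ∘ suc ⊛ D) (4 ℕ.+ n)
  drop t n = trans (cong (ℤ._+ (t ∘ suc ⊛ D) (4 ℕ.+ n)) (ℤ.*-zeroʳ (t 0))) (ℤ.+-identityˡ _)
  zero-sum : ∀ a b c d → a ℤ.* + 4 ℤ.+ (b ℤ.* -[1+ 3 ] ℤ.+ (c ℤ.* + 3 ℤ.+ (d ℤ.* -[1+ 3 ] ℤ.+
    ((+ 4 ℤ.* d ℤ.- + 3 ℤ.* c ℤ.+ + 4 ℤ.* b ℤ.- + 4 ℤ.* a) ℤ.* + 1 ℤ.+ 0ℤ)))) ≡ 0ℤ
  zero-sum = solve-∀
  vanish : ∀ n (t : Series) →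
    (∀ k → t (4 ℕ.+ k) ≡ + 4 ℤ.* t (3 ℕ.+ k) ℤ.- + 3 ℤ.* t (2 ℕ.+ k) ℤ.+ + 4 ℤ.* t (1 ℕ.+ k) ℤ.- + 4 ℤ.* t k) →
    (t ⊛ D) (4 ℕ.+ n) ≡ 0ℤ
  vanish zero t r rewrite r 0 = zero-sum (t 0) (t 1) (t 2) (t 3)
  vanish (suc n) t r = trans (drop t n) (vanish n (t ∘ suc) (r ∘ suc))
  product : s ⊛ D ≗ N
  product 0 rewrite s₀ = refl
  product 1 rewrite s₀ | s₁ = refl
  product 2 rewrite s₀ | s₁ | s₂ = refl
  product 3 rewrite s₀ | s₁ | s₂ | s₃ = refl
  product 4 rewrite s₀ | s₁ | s₂ | s₃ | s₄ = refl
  product 5 rewrite s₀ | s₁ | s₂ | s₃ | s₄ | s₅ = refl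
  product (suc (suc (suc (suc (suc (suc n)))))) =
    trans (drop s (suc n)) (trans (drop (s ∘ suc) n) (vanish n (λ k → s (2 ℕ.+ k)) rec))

-- Adjacency

∣-∣-swap : ∀ i j → ℤ.∣ i ℤ.- j ∣ ≡ ℤ.∣ j ℤ.- i ∣
∣-∣-swap i j = trans (cong ℤ.∣_∣ (swap i j)) (ℤ.∣-i∣≡∣i∣ (j ℤ.- i))
  where
  swap : ∀ i j → i ℤ.- j ≡ ℤ.- (j ℤ.- i)
  swap = solve-∀

adjacent-sym : ∀ c d → Adjacent c d → Adjacent d c
adjacent-sym (x , y , z) (x′ , y′ , z′)
  rewrite ∣-∣-swap x x′ | ∣-∣-swap y y′ | ∣-∣-swap z z′ = λ adj → adj

adjacent-irrefl : ∀ c → ¬ Adjacent c c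
adjacent-irrefl (x , y , z)
  rewrite ℤ.+-inverseʳ x | ℤ.+-inverseʳ y | ℤ.+-inverseʳ z = λ ()

-- Induced paths

Far : Cell → Cell → Set
Far c d = c ≢ d × ¬ Adjacent c d

-- A chordless path. Each cell is compared with all later ones at once, so distinctness, the degree
-- bound and acyclicity can all be proved by induction on the list.
data Induced : List Cell → Set where
  []  : Induced []
  [-] : ∀ {c} → Induced [ c ]
  cons : ∀ {c d P} → Adjacent c d → All (Far c) P → Induced (d ∷ P) → Induced (c ∷ d ∷ P)

induced⇒linked : ∀ {P} → Induced P → Linked Adjacent P
induced⇒linked []            = []
induced⇒linked [-]           = [-]
induced⇒linked (cons adj _ P) = adj ∷ induced⇒linked P

induced⇒unique : ∀ {P} → Induced P → Unique P
induced⇒unique []              = []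
induced⇒unique [-]             = [] ∷ []
induced⇒unique (cons {c} adj far P) =
  ((λ { refl → adjacent-irrefl c adj }) ∷ All.map proj₁ far) ∷ induced⇒unique P

linked⇒connected : ∀ {P} → Linked Adjacent P → Connected P
linked⇒connected [-]       (here refl) (here refl) = Star.ε
linked⇒connected (adj ∷ P) (here refl) (here refl) = Star.ε
linked⇒connected (adj ∷ P) (here refl) (there b∈)  =
  (adj , there (here refl)) ◅ Star.map (λ (a , ∈P) → a , there ∈P) (linked⇒connected P (here refl) b∈)
linked⇒connected {c ∷ d ∷ _} (adj ∷ P) (there a∈)  (here refl) =
  Star.map (λ (a , ∈P) → a , there ∈P) (linked⇒connected P a∈ (here refl))
    ◅◅ (adjacent-sym c d adj , here refl) ◅ Star.ε
linked⇒connected (adj ∷ P) (there a∈)  (there b∈)  =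
  Star.map (λ (a , ∈P) → a , there ∈P) (linked⇒connected P a∈ b∈)

head-neighbour : ∀ {c d P e} → Induced (c ∷ d ∷ P) → e ∈ c ∷ d ∷ P → Adjacent c e → e ≡ d
head-neighbour {c} _            (here refl)         adj = ⊥-elim (adjacent-irrefl c adj)
head-neighbour _             (there (here refl)) adj = refl
head-neighbour (cons _ far _) (there (there e∈))  adj = ⊥-elim (proj₂ (All.lookup far e∈) adj)

-- Phrased through membership rather than `degree`, so that it passes between lists with the same
-- members.
End : List Cell → Cell → Set
End P v = ∀ {a b} → a ∈ P → b ∈ P → Adjacent v a → Adjacent v b → a ≡ b

head-end : ∀ {c P} → Induced (c ∷ P) → End (c ∷ P) c
head-end {c} [-]           (here refl) _ adj _ = ⊥-elim (adjacent-irrefl c adj)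
head-end I@(cons _ _ _) a∈ b∈ va vb = trans (head-neighbour I a∈ va) (sym (head-neighbour I b∈ vb))

-- Acyclicity

linked-last : ∀ {a b} l → Linked Adjacent (a ∷ l ++ [ b ]) → l ≢ [] → ∃[ e ] e ∈ l × Adjacent e b
linked-last []          _                   l≢[] = ⊥-elim (l≢[] refl)
linked-last (e ∷ [])    (_ ∷ (adj ∷ [-]))   _    = e , here refl , adj
linked-last (e ∷ f ∷ l) (_ ∷ linked)        _    with linked-last (f ∷ l) linked (λ ())
... | g , g∈ , adj = g , there g∈ , adj

TwoNeighbours : List Cell → Cell → Set
TwoNeighbours P v = ∃[ p ] ∃[ q ] p ∈ P × q ∈ P × p ≢ q × Adjacent v p × Adjacent v q

-- The witnesses are the predecessor and the successor of v. They could coincide only if l is the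
-- single cell v and a ≡ b. The length hypothesis excludes this at the outset, and b ∉ l after a
-- step of the recursion.
inner-two-neighbours : ∀ {a b v} l → Linked Adjacent (a ∷ l ++ [ b ]) → Unique (a ∷ l) → b ∉ l →
  (a ≡ b → 2 ℕ.≤ length l) → v ∈ l → TwoNeighbours (a ∷ l ++ [ b ]) v
inner-two-neighbours {a} {b} (v ∷ []) (av ∷ (vb ∷ [-])) _ _ a≡b⇒ (here refl) =
  a , b , here refl , there (there (here refl)) ,
  (λ a≡b → ℕ.<⇒≱ (s≤s (s≤s z≤n)) (a≡b⇒ a≡b)) , adjacent-sym a v av , vb
inner-two-neighbours {a} {v = v} (v ∷ e ∷ l) (av ∷ (ve ∷ _)) ((_ ∷ (a≢e ∷ _)) ∷ _) _ _ (here refl) =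
  a , e , here refl , there (there (here refl)) , a≢e , adjacent-sym a v av , ve
inner-two-neighbours (u ∷ l) (_ ∷ linked) (_ ∷ unique) b∉ _ (there v∈)
  with inner-two-neighbours l linked unique (λ b∈ → b∉ (there b∈)) (λ { refl → ⊥-elim (b∉ (here refl)) }) v∈
... | p , q , p∈ , q∈ , rest = p , q , there p∈ , there q∈ , rest

module _ {P} (cycle : Cycle P) where
  open Cycle cycle

  private
    ∈-closed : ∀ {e} → e ∈ c ∷ cs ++ [ c ] → e ∈ c ∷ cs
    ∈-closed (here refl) = here refl
    ∈-closed (there e∈) with ∈-++⁻ cs e∈
    ... | inj₁ e∈cs        = there e∈cs
    ... | inj₂ (here refl) = here refl

  cycle-two-neighbours : ∀ {v} → v ∈ c ∷ cs → TwoNeighbours (c ∷ cs) v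
  cycle-two-neighbours (here refl) with cs in eq | distinct | length≥3 | closed
  ... | d ∷ e ∷ ds | _ ∷ (d≢ ∷ _) | _ | cd ∷ linked with linked-last (e ∷ ds) linked (λ ())
  ...   | f , f∈ , fc = d , f , there (here refl) , there (there f∈) , All.lookup d≢ f∈ , cd , adjacent-sym f c fc
  cycle-two-neighbours (here refl) | [] | _ | s≤s () | _
  cycle-two-neighbours (here refl) | _ ∷ [] | _ | s≤s (s≤s ()) | _
  cycle-two-neighbours (there v∈)
    with inner-two-neighbours cs closed distinct c∉cs (λ _ → ℕ.s≤s⁻¹ length≥3) v∈
    where
    c∉cs : c ∉ cs
    c∉cs c∈ with distinct
    ... | c≢ ∷ _ = All.lookup c≢ c∈ refl
  ... | p , q , p∈ , q∈ , rest = p , q , ∈-closed p∈ , ∈-closed q∈ , rest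

-- The cell of C that comes first along the path has at most one neighbour in C; the recursion drops
-- cells of the path until it meets that cell. Taking any nonempty C instead of a cycle avoids
-- rotating the cycle to start there.
induced⇒no-two-neighbours : ∀ {P} → Induced P → ∀ C → (∃[ v ] v ∈ C) → All (_∈ P) C →
  ¬ (∀ {v} → v ∈ C → TwoNeighbours C v)
induced⇒no-two-neighbours [] C (v , v∈) C⊆P _ with All.lookup C⊆P v∈
... | ()
induced⇒no-two-neighbours [-] C (v , v∈) C⊆P two with two v∈
... | p , q , p∈ , q∈ , p≢q , _ with All.lookup C⊆P p∈ | All.lookup C⊆P q∈
...   | here refl | here refl = p≢q refl
induced⇒no-two-neighbours {c ∷ _} I@(cons _ _ I′) C nonempty C⊆P two with any? (≡-dec ℤ._≟_ (≡-dec ℤ._≟_ ℤ._≟_) c) C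
... | yes c∈ with two c∈
...   | p , q , p∈ , q∈ , p≢q , cp , cq = p≢q (head-end I (All.lookup C⊆P p∈) (All.lookup C⊆P q∈) cp cq)
induced⇒no-two-neighbours I@(cons _ _ I′) C nonempty C⊆P two | no c∉ =
  induced⇒no-two-neighbours I′ C nonempty (All.tabulate λ e∈ → tail e∈ (All.lookup C⊆P e∈)) two
  where
  tail : ∀ {e} → e ∈ C → e ∈ _ ∷ _ → e ∈ _
  tail e∈ (here refl) = ⊥-elim (c∉ e∈)
  tail _  (there e∈)  = e∈

induced⇒acyclic : ∀ {P} → Induced P → ¬ Cycle P
induced⇒acyclic I cycle = induced⇒no-two-neighbours I (c ∷ cs) (c , here refl) cells⊆P
  (cycle-two-neighbours cycle)
  where open Cycle cycle

-- Degrees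

degree-far : ∀ c P → All (λ d → ¬ Adjacent c d) P → degree P c ≡ 0
degree-far c P far = cong length (List.filter-none (adjacent? c) far)

degree-cons : ∀ c d P → degree (d ∷ P) c ℕ.≤ suc (degree P c)
degree-cons c d P with adjacent? c d
... | yes adj = ℕ.≤-reflexive (cong length (List.filter-accept (adjacent? c) adj))
... | no ¬adj = ℕ.≤-trans (ℕ.≤-reflexive (cong length (List.filter-reject (adjacent? c) ¬adj))) (ℕ.n≤1+n _)

degree-skip : ∀ c d P → ¬ Adjacent c d → degree (d ∷ P) c ≡ degree P c
degree-skip c d P ¬adj = cong length (List.filter-reject (adjacent? c) ¬adj)

head-degree : ∀ {c P} → Induced (c ∷ P) → degree (c ∷ P) c ℕ.≤ 1
head-degree {c} [-] = ℕ.≤-trans (ℕ.≤-reflexive (degree-skip c c [] (adjacent-irrefl c))) z≤n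
head-degree {c} {d ∷ P} (cons _ far _) = begin
  degree (c ∷ d ∷ P) c   ≡⟨ degree-skip c c (d ∷ P) (adjacent-irrefl c) ⟩
  degree (d ∷ P) c       ≤⟨ degree-cons c d P ⟩
  suc (degree P c)       ≡⟨ cong suc (degree-far c P (All.map proj₂ far)) ⟩
  1                      ∎
  where open ℕ.≤-Reasoning

-- Among the cells before c only its immediate predecessor can touch it, and from c onwards
-- `head-degree` allows one neighbour.
induced⇒degree≤2 : ∀ {P c} → Induced P → c ∈ P → degree P c ℕ.≤ 2
induced⇒degree≤2 I (here refl) = ℕ.m≤n⇒m≤1+n (head-degree I)
induced⇒degree≤2 {d ∷ _ ∷ P} {c} (cons _ _ I) (there (here refl)) = ℕ.≤-trans (degree-cons c d (c ∷ P)) (s≤s (head-degree I))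
induced⇒degree≤2 {d ∷ e ∷ P} {c} (cons _ far I) (there c∈@(there c∈P)) = ℕ.≤-trans
  (ℕ.≤-reflexive (degree-skip c d (e ∷ P) (λ adj → proj₂ (All.lookup far c∈P) (adjacent-sym c d adj)))) (induced⇒degree≤2 I c∈)

induced⇒snake : ∀ {P} → Induced P → IsSnake P
induced⇒snake I = record
  { unique    = induced⇒unique I
  ; connected = linked⇒connected (induced⇒linked I)
  ; acyclic   = induced⇒acyclic I
  ; degree≤2  = induced⇒degree≤2 I
  }

-- Distances

distance : Cell → Cell → ℕ
distance (x , y , z) (x′ , y′ , z′) = ℤ.∣ x ℤ.- x′ ∣ ℕ.+ ℤ.∣ y ℤ.- y′ ∣ ℕ.+ ℤ.∣ z ℤ.- z′ ∣

norm : Cell → ℕ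
norm (x , y , z) = ℤ.∣ x ∣ ℕ.+ ℤ.∣ y ∣ ℕ.+ ℤ.∣ z ∣

distance-⊕ : ∀ c d → distance c (c ⊕ d) ≡ norm d
distance-⊕ (x , y , z) (x′ , y′ , z′) = cong₂ ℕ._+_ (cong₂ ℕ._+_ (abs x x′) (abs y y′)) (abs z z′)
  where
  abs : ∀ i j → ℤ.∣ i ℤ.- (i ℤ.+ j) ∣ ≡ ℤ.∣ j ∣
  abs i j = trans (cong ℤ.∣_∣ (cancel i j)) (ℤ.∣-i∣≡∣i∣ j)
    where
    cancel : ∀ i j → i ℤ.- (i ℤ.+ j) ≡ ℤ.- j
    cancel = solve-∀

distance-refl : ∀ c → distance c c ≡ 0
distance-refl (x , y , z) rewrite ℤ.+-inverseʳ x | ℤ.+-inverseʳ y | ℤ.+-inverseʳ z = refl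

norm≥2⇒far : ∀ c d → 2 ℕ.≤ norm d → Far c (c ⊕ d)
norm≥2⇒far c d 2≤ =
  (λ c≡ → ℕ.<⇒≢ (ℕ.≤-trans (s≤s z≤n) 2≤) (trans (sym (distance-refl c)) (trans (cong (distance c) c≡) (distance-⊕ c d)))) ,
  (λ adj → ℕ.<⇒≢ 2≤ (trans (sym adj) (distance-⊕ c d)))

adjacent-step : ∀ c s → Adjacent c (c ⊕ unitVector s)
adjacent-step c s = trans (distance-⊕ c (unitVector s)) (norm-unit s)
  where
  norm-unit : ∀ s → norm (unitVector s) ≡ 1
  norm-unit x⁺ = refl
  norm-unit x⁻ = refl
  norm-unit y⁺ = refl
  norm-unit z⁺ = refl

⊕-cancelˡ : ∀ c {d e} → c ⊕ d ≡ c ⊕ e → d ≡ e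
⊕-cancelˡ c {d} {e} eq = begin
  d                 ≡⟨ ⊕-identityˡ d ⟨
  origin ⊕ d        ≡⟨ cong (_⊕ d) (neg-inverseˡ c) ⟨
  neg c ⊕ c ⊕ d     ≡⟨ ⊕-assoc (neg c) c d ⟩
  neg c ⊕ (c ⊕ d)   ≡⟨ cong (neg c ⊕_) eq ⟩
  neg c ⊕ (c ⊕ e)   ≡⟨ ⊕-assoc (neg c) c e ⟨
  neg c ⊕ c ⊕ e     ≡⟨ cong (_⊕ e) (neg-inverseˡ c) ⟩
  origin ⊕ e        ≡⟨ ⊕-identityˡ e ⟩
  e                 ∎
  where open ≡-Reasoning

-- Words

xdir : Sign → Direction
xdir Sign.+ = x⁺
xdir Sign.- = x⁻

data Up : Direction → Set where
  up-y : Up y⁺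
  up-z : Up z⁺

data Kind : Direction → Set where
  across : ∀ s → Kind (xdir s)
  up     : ∀ {u} → Up u → Kind u

kind : ∀ t → Kind t
kind x⁺ = across Sign.+
kind x⁻ = across Sign.-
kind y⁺ = up up-y
kind z⁺ = up up-z

-- The last steps of a word that restrict the next one: in state `run s` the
-- last step was along x with sign s, in state `rise s` such a step was followed
-- by a single y⁺ or z⁺.
data State : Set where
  free     : State
  run rise : Sign → State

climb : State → State
climb free     = free
climb (run s)  = rise s
climb (rise _) = free

data Allows : State → Sign → Set where
  free : ∀ {s} → Allows free s
  run  : ∀ {s} → Allows (run s) s
  rise : ∀ {s} → Allows (rise s) s

data Good (σ : State) : List Direction → Set where
  []     : Good σ []
  across : ∀ {s w} → Allows σ s → Good (run s) w → Good σ (xdir s ∷ w)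
  up     : ∀ {u w} → Up u → Good (climb σ) w → Good σ (u ∷ w)

steps : Cell → List Direction → List Cell
steps c []      = []
steps c (s ∷ w) = c ⊕ unitVector s ∷ steps (c ⊕ unitVector s) w

path : Cell → List Direction → List Cell
path c w = c ∷ steps c w

-- Good words give induced paths

-- Besides the level y + z this records that y and z are natural numbers, so that together they
-- contribute exactly h to the ℓ¹ norm.
record Height (d : Cell) (h : ℕ) : Set where
  constructor height
  field
    j k : ℕ
    y≡j : proj₁ (proj₂ d) ≡ + j
    z≡k : proj₂ (proj₂ d) ≡ + k
    j+k≡h : j ℕ.+ k ≡ h

-- For m = 0 the value x = 0 belongs to both signs, which lets a walk that begins with a rise still
-- turn either way.
record Along (s : Sign) (m : ℕ) (d : Cell) : Set where
  constructor along
  field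
    i   : ℕ
    m≤i : m ℕ.≤ i
    x≡i : proj₁ d ≡ s ◃ i

height-across : ∀ {d h} s → Height d h → Height (d ⊕ unitVector (xdir s)) h
height-across {_ , _ , _} Sign.+ (height j k refl refl refl) =
  height j k (cong +_ (ℕ.+-identityʳ j)) (cong +_ (ℕ.+-identityʳ k)) refl
height-across {_ , _ , _} Sign.- (height j k refl refl refl) =
  height j k (cong +_ (ℕ.+-identityʳ j)) (cong +_ (ℕ.+-identityʳ k)) refl

height-up : ∀ {d h u} → Up u → Height d h → Height (d ⊕ unitVector u) (suc h)
height-up {_ , _ , _} up-y (height j k refl refl refl) =
  height (j ℕ.+ 1) k refl (cong +_ (ℕ.+-identityʳ k)) (cong (ℕ._+ k) (ℕ.+-comm j 1))
height-up {_ , _ , _} up-z (height j k refl refl refl) =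
  height j (k ℕ.+ 1) (cong +_ (ℕ.+-identityʳ j)) refl
  (trans (cong (j ℕ.+_) (ℕ.+-comm k 1)) (ℕ.+-suc j k))

along-across : ∀ {d m} s → Along s m d → Along s (suc m) (d ⊕ unitVector (xdir s))
along-across {_ , _ , _} Sign.+ (along i m≤i refl) = along (suc i) (s≤s m≤i) (add i)
  where
  add : ∀ i → (Sign.+ ◃ i) ℤ.+ 1ℤ ≡ Sign.+ ◃ suc i
  add zero    = refl
  add (suc i) = cong (λ k → + suc k) (ℕ.+-comm i 1)
along-across {_ , _ , _} Sign.- (along i m≤i refl) = along (suc i) (s≤s m≤i) (add i)
  where
  add : ∀ i → (Sign.- ◃ i) ℤ.+ ℤ.-1ℤ ≡ Sign.- ◃ suc i
  add zero    = refl
  add (suc i) = cong (λ k → -[1+ suc k ]) (ℕ.+-identityʳ i)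

along-up : ∀ {d m s u} → Up u → Along s m d → Along s m (d ⊕ unitVector u)
along-up {_ , _ , _} up-y (along i m≤i refl) = along i m≤i (ℤ.+-identityʳ _)
along-up {_ , _ , _} up-z (along i m≤i refl) = along i m≤i (ℤ.+-identityʳ _)

along-weaken : ∀ {d m s} → Along s (suc m) d → Along s m d
along-weaken (along i m<i eq) = along i (ℕ.<⇒≤ m<i) eq

height≤norm : ∀ {d h} → Height d h → h ℕ.≤ norm d
height≤norm {x , _ , _} (height j k refl refl refl) = ℕ.≤-trans (ℕ.m≤n+m (j ℕ.+ k) ℤ.∣ x ∣)
  (ℕ.≤-reflexive (sym (ℕ.+-assoc ℤ.∣ x ∣ j k)))

along+height≤norm : ∀ {d m h s} → Along s m d → Height d h → m ℕ.+ h ℕ.≤ norm d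
along+height≤norm {_ , _ , _} {s = s} (along i m≤i refl) (height j k refl refl refl) rewrite ℤ.abs-◃ s i =
  ℕ.≤-trans (ℕ.+-monoˡ-≤ (j ℕ.+ k) m≤i) (ℕ.≤-reflexive (sym (ℕ.+-assoc i j k)))

-- Displacements of the cells after the first step ...
data Near : State → Cell → Set where
  near-across : ∀ {s d} → Along s 1 d → Height d 0 → Near (run s) d
  near-up     : ∀ {σ d} → (∀ s → Along s 0 d) → Height d 1 → Near σ d

-- ... and after at least two.
data Beyond : State → Cell → Set where
  straight : ∀ {s d} → Along s 2 d → Height d 0 → Beyond (run s) d
  beside   : ∀ {s d} → Along s 1 d → Height d 1 → Beyond (run s) d
  beside′  : ∀ {s d} → Along s 1 d → Height d 1 → Beyond (rise s) d
  above    : ∀ {σ d h} → Height d (2 ℕ.+ h) → Beyond σ d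

beyond⇒far : ∀ {σ d} c → Beyond σ d → Far c (c ⊕ d)
beyond⇒far {d = d} c (straight al ht) = norm≥2⇒far c d (along+height≤norm al ht)
beyond⇒far {d = d} c (beside al ht)   = norm≥2⇒far c d (along+height≤norm al ht)
beyond⇒far {d = d} c (beside′ al ht)  = norm≥2⇒far c d (along+height≤norm al ht)
beyond⇒far {d = d} c (above ht)       = norm≥2⇒far c d (ℕ.≤-trans (s≤s (s≤s z≤n)) (height≤norm ht))

near-first : ∀ {σ w t} → Good σ (t ∷ w) → ∃[ τ ] Near τ (unitVector t) × Good τ w
near-first (across {s} _ good) = run s , near-across (along-first s) (height-first s) , good
  where
  along-first : ∀ s → Along s 1 (unitVector (xdir s))
  along-first Sign.+ = along 1 ℕ.≤-refl refl
  along-first Sign.- = along 1 ℕ.≤-refl refl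
  height-first : ∀ s → Height (unitVector (xdir s)) 0
  height-first Sign.+ = height 0 0 refl refl refl
  height-first Sign.- = height 0 0 refl refl refl
near-first (up up-y good) = _ , near-up (λ { Sign.+ → along 0 z≤n refl ; Sign.- → along 0 z≤n refl }) (height 1 0 refl refl refl) , good
near-first (up up-z good) = _ , near-up (λ { Sign.+ → along 0 z≤n refl ; Sign.- → along 0 z≤n refl }) (height 0 1 refl refl refl) , good

near-next : ∀ {σ w t d} → Near σ d → Good σ (t ∷ w) → ∃[ τ ] Beyond τ (d ⊕ unitVector t) × Good τ w
near-next (near-across al ht) (across {s} run good) = _ , straight (along-across s al) (height-across s ht) , good
near-next (near-across al ht) (up u good)           = _ , beside′ (along-up u al) (height-up u ht) , good
near-next (near-up al ht)     (across {s} _ good)   = _ , beside (along-across s (al s)) (height-across s ht) , good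
near-next (near-up al ht)     (up u good)           = _ , above (height-up u ht) , good

-- Below level two the state forces every step along x to lead further away from the start. From
-- level two on the level alone keeps the distance, so `above` accepts any state.
beyond-next : ∀ {σ w t d} → Beyond σ d → Good σ (t ∷ w) → ∃[ τ ] Beyond τ (d ⊕ unitVector t) × Good τ w
beyond-next (straight al ht) (across {s} run good) = _ , straight (along-weaken (along-across s al)) (height-across s ht) , good
beyond-next (straight al ht) (up u good)           = _ , beside′ (along-weaken (along-up u al)) (height-up u ht) , good
beyond-next (beside al ht)   (across {s} run good) = _ , beside (along-weaken (along-across s al)) (height-across s ht) , good
beyond-next (beside al ht)   (up u good)           = _ , above (height-up u ht) , good
beyond-next (beside′ al ht)  (across {s} rise good) = _ , beside (along-weaken (along-across s al)) (height-across s ht) , good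
beyond-next (beside′ al ht)  (up u good)           = _ , above (height-up u ht) , good
beyond-next (above ht)       (across {s} _ good)   = _ , above (height-across s ht) , good
beyond-next (above ht)       (up u good)           = _ , above (height-up u ht) , good

far-path : ∀ {σ d} c w → Beyond σ d → Good σ w → All (Far c) (path (c ⊕ d) w)
far-path c []      beyond _    = beyond⇒far c beyond ∷ []
far-path {d = d} c (t ∷ w) beyond good with beyond-next beyond good
... | _ , beyond′ , good′ = beyond⇒far c beyond ∷
  subst (λ e → All (Far c) (path e w)) (sym (⊕-assoc c d (unitVector t))) (far-path c w beyond′ good′)

good⇒induced : ∀ {σ} c w → Good σ w → Induced (path c w)
good⇒induced c []          _    = [-]
good⇒induced c (s ∷ [])    _    = cons (adjacent-step c s) [] [-]
good⇒induced c (s ∷ t ∷ w) good =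
  let _ , near , good′   = near-first good
      _ , beyond , good″ = near-next near good′
  in cons (adjacent-step c s)
    (subst (λ e → All (Far c) (path e w)) (sym (⊕-assoc c (unitVector s) (unitVector t))) (far-path c w beyond good″))
    (good⇒induced (c ⊕ unitVector s) (t ∷ w) good′)

-- Snakes have good words

-- These two conditions pass to the tail of a list, so an induction over the word can carry them.
record Simple (P : List Cell) : Set where
  field
    unique  : Unique P
    acyclic : ¬ Cycle P

simple-tail : ∀ {c P} → Simple (c ∷ P) → Simple P
simple-tail simple with Simple.unique simple
... | _ ∷ unique = record
  { unique  = unique
  ; acyclic = λ cycle → Simple.acyclic simple record
    { Cycle cycle ; cells⊆P = All.map there (Cycle.cells⊆P cycle) }
  }

xdir-opposite : ∀ s s′ → s ≢ s′ → unitVector (xdir s) ⊕ unitVector (xdir s′) ≡ origin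
xdir-opposite Sign.+ Sign.+ s≢s = ⊥-elim (s≢s refl)
xdir-opposite Sign.+ Sign.- _   = refl
xdir-opposite Sign.- Sign.+ _   = refl
xdir-opposite Sign.- Sign.- s≢s = ⊥-elim (s≢s refl)

⊕-comm : ∀ c d → c ⊕ d ≡ d ⊕ c
⊕-comm (x , y , z) (x′ , y′ , z′) = cong₂ _,_ (ℤ.+-comm x x′) (cong₂ _,_ (ℤ.+-comm y y′) (ℤ.+-comm z z′))

⊕-identityʳ : ∀ c → c ⊕ origin ≡ c
⊕-identityʳ c = trans (⊕-comm c origin) (⊕-identityˡ c)

return : ∀ c s s′ → s ≢ s′ → c ⊕ unitVector (xdir s) ⊕ unitVector (xdir s′) ≡ c
return c s s′ s≢s′ = trans (⊕-assoc c _ _) (trans (cong (c ⊕_) (xdir-opposite s s′ s≢s′)) (⊕-identityʳ c))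

detour : ∀ c s s′ u → s ≢ s′ → c ⊕ unitVector (xdir s) ⊕ unitVector u ⊕ unitVector (xdir s′) ≡ c ⊕ unitVector u
detour c s s′ u s≢s′ = begin
  c ⊕ a ⊕ e ⊕ b       ≡⟨ cong (_⊕ b) (trans (⊕-assoc c a e) (trans (cong (c ⊕_) (⊕-comm a e)) (sym (⊕-assoc c e a)))) ⟩
  c ⊕ e ⊕ a ⊕ b       ≡⟨ return (c ⊕ e) s s′ s≢s′ ⟩
  c ⊕ e               ∎
  where
  open ≡-Reasoning
  a = unitVector (xdir s)
  b = unitVector (xdir s′)
  e = unitVector u

no-return : ∀ c s s′ w → Simple (path c (xdir s ∷ xdir s′ ∷ w)) → s ≡ s′
no-return c s s′ w simple with s Sign.≟ s′
... | yes s≡s′ = s≡s′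
... | no  s≢s′ with Simple.unique simple
...   | (_ ∷ c≢ ∷ _) ∷ _ = ⊥-elim (c≢ (sym (return c s s′ s≢s′)))

-- With opposite signs the fourth cell is c ⊕ unitVector u, which touches c again: the four cells go
-- round a unit square.
no-detour : ∀ c s s′ u w → Simple (path c (xdir s ∷ u ∷ xdir s′ ∷ w)) → s ≡ s′
no-detour c s s′ u w simple with s Sign.≟ s′
... | yes s≡s′ = s≡s′
... | no  s≢s′ = ⊥-elim (Simple.acyclic simple record
  { c        = c
  ; cs       = _ ∷ _ ∷ _ ∷ []
  ; cells⊆P  = here refl ∷ there (here refl) ∷ there (there (here refl)) ∷ there (there (there (here refl))) ∷ []
  ; distinct = Unique.take⁺ 4 (Simple.unique simple)
  ; length≥3 = s≤s (s≤s (s≤s z≤n))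
  ; closed   = adjacent-step c (xdir s) ∷ adjacent-step d u ∷ adjacent-step e (xdir s′) ∷
      subst (λ f → Adjacent f c) (sym (detour c s s′ u s≢s′))
        (adjacent-sym c (c ⊕ unitVector u) (adjacent-step c u)) ∷ [-]
  })
  where
  d = c ⊕ unitVector (xdir s)
  e = d ⊕ unitVector u

-- The statement for a state keeps the letters that led to it, because a forbidden pattern is
-- refuted by the cells that those letters visit.
simple⇒good-free : ∀ c w → Simple (path c w) → Good free w
simple⇒good-run  : ∀ c s w → Simple (path c (xdir s ∷ w)) → Good (run s) w
simple⇒good-rise : ∀ c s u w → Simple (path c (xdir s ∷ u ∷ w)) → Good (rise s) w

simple⇒good-free c []      simple = []
simple⇒good-free c (t ∷ w) simple with kind t
... | across s = across free (simple⇒good-run c s w simple)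
... | up u     = up u (simple⇒good-free _ w (simple-tail simple))

simple⇒good-run c s []      simple = []
simple⇒good-run c s (t ∷ w) simple with kind t
... | up u      = up u (simple⇒good-rise c s t w simple)
... | across s′ with no-return c s s′ w simple
...   | refl = across run (simple⇒good-run _ s w (simple-tail simple))

simple⇒good-rise c s u []      simple = []
simple⇒good-rise c s u (t ∷ w) simple with kind t
... | up u′     = up u′ (simple⇒good-free _ w (simple-tail (simple-tail (simple-tail simple))))
... | across s′ with no-detour c s s′ u w simple
...   | refl = across rise (simple⇒good-run _ s w (simple-tail (simple-tail simple)))

-- Words determined by their sets of cells

end : Cell → List Direction → Cell
end c []      = c
end c (s ∷ w) = end (c ⊕ unitVector s) w

-- In an induced path every cell between the two ends has two neighbours.
end-classify : ∀ c w {v} → Induced (path c w) → v ∈ path c w → End (path c w) v → v ≡ c ⊎ v ≡ end c w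
end-classify c []      I               (here refl) _ = inj₁ refl
end-classify c (s ∷ w) I               (here refl) _ = inj₁ refl
end-classify c (s ∷ w) (cons adj far I) (there v∈) v-end
  with end-classify (c ⊕ unitVector s) w I v∈ (λ a∈ b∈ → v-end (there a∈) (there b∈))
... | inj₂ v≡end = inj₂ v≡end
... | inj₁ refl with w | far
...   | []    | _ = inj₂ refl
...   | t ∷ w | (c≢ , _) ∷ _ = ⊥-elim (c≢ (v-end (here refl) (there (there (here refl)))
  (adjacent-sym c (c ⊕ unitVector s) adj) (adjacent-step (c ⊕ unitVector s) t)))

rises : List Direction → ℕ
rises []       = 0
rises (x⁺ ∷ w) = rises w
rises (x⁻ ∷ w) = rises w
rises (y⁺ ∷ w) = suc (rises w)
rises (z⁺ ∷ w) = suc (rises w)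

elevation : Cell → ℤ
elevation (_ , y , z) = y ℤ.+ z

elevation-end : ∀ c w → elevation (end c w) ≡ elevation c ℤ.+ + rises w
elevation-end c []       = sym (ℤ.+-identityʳ _)
elevation-end (x , y , z) (x⁺ ∷ w) rewrite elevation-end (x ℤ.+ 1ℤ , y ℤ.+ 0ℤ , z ℤ.+ 0ℤ) w
  | ℤ.+-identityʳ y | ℤ.+-identityʳ z = refl
elevation-end (x , y , z) (x⁻ ∷ w) rewrite elevation-end (x ℤ.+ ℤ.-1ℤ , y ℤ.+ 0ℤ , z ℤ.+ 0ℤ) w
  | ℤ.+-identityʳ y | ℤ.+-identityʳ z = refl
elevation-end (x , y , z) (y⁺ ∷ w) = trans (elevation-end (x ℤ.+ 0ℤ , y ℤ.+ 1ℤ , z ℤ.+ 0ℤ) w) (shift y z (+ rises w))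
  where
  shift : ∀ y z r → y ℤ.+ 1ℤ ℤ.+ (z ℤ.+ 0ℤ) ℤ.+ r ≡ y ℤ.+ z ℤ.+ (1ℤ ℤ.+ r)
  shift = solve-∀
elevation-end (x , y , z) (z⁺ ∷ w) = trans (elevation-end (x ℤ.+ 0ℤ , y ℤ.+ 0ℤ , z ℤ.+ 1ℤ) w) (shift y z (+ rises w))
  where
  shift : ∀ y z r → y ℤ.+ 0ℤ ℤ.+ (z ℤ.+ 1ℤ) ℤ.+ r ≡ y ℤ.+ z ℤ.+ (1ℤ ℤ.+ r)
  shift = solve-∀

flat-run : ∀ {s} w → Good (run s) w → rises w ≡ 0 → ∃[ n ] w ≡ replicate n (xdir s)
flat-run []      _    _ = 0 , refl
flat-run (_ ∷ w) (across {Sign.+} run good) flat with flat-run w good flat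
... | n , refl = suc n , refl
flat-run (_ ∷ w) (across {Sign.-} run good) flat with flat-run w good flat
... | n , refl = suc n , refl
flat-run (_ ∷ w) (up up-y _) ()
flat-run (_ ∷ w) (up up-z _) ()

flat-free : ∀ w → Good free w → rises w ≡ 0 → ∃[ s ] ∃[ n ] w ≡ replicate n (xdir s)
flat-free []      _    _ = Sign.+ , 0 , refl
flat-free (_ ∷ w) (across {Sign.+} _ good) flat with flat-run w good flat
... | n , refl = Sign.+ , suc n , refl
flat-free (_ ∷ w) (across {Sign.-} _ good) flat with flat-run w good flat
... | n , refl = Sign.- , suc n , refl
flat-free (_ ∷ w) (up up-y _) ()
flat-free (_ ∷ w) (up up-z _) ()

-- A straight snake along x is listed by a power of x⁺ and by one of x⁻; only
-- the former is kept.
record Canonical (w : List Direction) : Set where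
  constructor canonical
  field
    good      : Good free w
    forwards  : ∀ n → w ≢ replicate (suc n) x⁻

canonical-flat : ∀ w → Canonical w → rises w ≡ 0 → ∃[ n ] w ≡ replicate n x⁺
canonical-flat w (canonical good forwards) flat with flat-free w good flat
... | Sign.+ , n     , eq = n , eq
... | Sign.- , zero  , eq = 0 , eq
... | Sign.- , suc n , eq = ⊥-elim (forwards n eq)

end-x⁺ : ∀ c n → end c (replicate n x⁺) ≡ c ⊕ (+ n , 0ℤ , 0ℤ)
end-x⁺ c zero    = sym (⊕-identityʳ c)
end-x⁺ c (suc n) = trans (end-x⁺ (c ⊕ unitVector x⁺) n) (⊕-assoc c (unitVector x⁺) (+ n , 0ℤ , 0ℤ))

adjacent⇒≢ : ∀ {c d} → Adjacent c d → c ≢ d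
adjacent⇒≢ {c} adj refl = adjacent-irrefl c adj

unitVector-injective : ∀ s t → unitVector s ≡ unitVector t → s ≡ t
unitVector-injective x⁺ x⁺ _ = refl
unitVector-injective x⁻ x⁻ _ = refl
unitVector-injective y⁺ y⁺ _ = refl
unitVector-injective z⁺ z⁺ _ = refl

to : ∀ {P Q : List Cell} → P ∼[ set ] Q → ∀ {a} → a ∈ P → a ∈ Q
to P∼Q = Equivalence.to P∼Q

from : ∀ {P Q : List Cell} → P ∼[ set ] Q → ∀ {a} → a ∈ Q → a ∈ P
from P∼Q = Equivalence.from P∼Q

-- The second cell is the only neighbour of the start, so the set determines the first letter. As no
-- cell repeats, removing the start leaves equal sets again.
same-start : ∀ c w w′ → Induced (path c w) → Induced (path c w′) → path c w ∼[ set ] path c w′ → w ≡ w′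
same-start c []      []       _ _ _ = refl
same-start c []      (t ∷ w′) _ _ P∼Q with from P∼Q (there (here refl))
... | here c⊕t≡c = ⊥-elim (adjacent⇒≢ (adjacent-step c t) (sym c⊕t≡c))
same-start c (s ∷ w) []       _ _ P∼Q with to P∼Q (there (here refl))
... | here c⊕s≡c = ⊥-elim (adjacent⇒≢ (adjacent-step c s) (sym c⊕s≡c))
same-start c (s ∷ w) (t ∷ w′) I@(cons _ _ I₁) J@(cons _ _ J₁) P∼Q
  with unitVector-injective s t (⊕-cancelˡ c (head-neighbour J (to P∼Q (there (here refl))) (adjacent-step c s)))
... | refl = cong (s ∷_) (same-start (c ⊕ unitVector s) w w′ I₁ J₁
    (mk⇔ (λ a∈ → tail (c∉ (induced⇒unique I) a∈) (to P∼Q (there a∈)))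
         (λ a∈ → tail (c∉ (induced⇒unique J) a∈) (from P∼Q (there a∈)))))
  where
  c∉ : ∀ {a P} → Unique (c ∷ P) → a ∈ P → a ≢ c
  c∉ (c≢ ∷ _) a∈ refl = All.lookup c≢ a∈ refl
  tail : ∀ {a P} → a ≢ c → a ∈ c ∷ P → a ∈ P
  tail a≢c (here a≡c) = ⊥-elim (a≢c a≡c)
  tail _   (there a∈) = a∈

-- Each start is an end of the common set. If neither comparison gives c ≡ d, each walk ends where
-- the other one starts. The two then form a closed loop along which y + z never decreases, so both
-- are flat. Being canonical they are powers of x⁺, and such a loop closes only if both are empty.
same-set : ∀ c d w w′ → Canonical w → Canonical w′ → path c w ∼[ set ] path d w′ → w ≡ w′
same-set c d w w′ w-can w′-can P∼Q
  with end-classify d w′ J (to P∼Q (here refl)) (λ a∈ b∈ → head-end I (from P∼Q a∈) (from P∼Q b∈))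
     | end-classify c w I (from P∼Q (here refl)) (λ a∈ b∈ → head-end J (to P∼Q a∈) (to P∼Q b∈))
  where
  I = good⇒induced c w (Canonical.good w-can)
  J = good⇒induced d w′ (Canonical.good w′-can)
... | inj₁ refl | _ = same-start c w w′ (good⇒induced c w (Canonical.good w-can)) (good⇒induced c w′ (Canonical.good w′-can)) P∼Q
... | inj₂ _ | inj₁ refl = same-start c w w′ (good⇒induced c w (Canonical.good w-can)) (good⇒induced c w′ (Canonical.good w′-can)) P∼Q
... | inj₂ c≡ | inj₂ d≡ = powers
  where
  loop : elevation c ≡ elevation c ℤ.+ + (rises w ℕ.+ rises w′)
  loop = begin
    elevation c                                     ≡⟨ cong elevation c≡ ⟩
    elevation (end d w′)                            ≡⟨ elevation-end d w′ ⟩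
    elevation d ℤ.+ + rises w′                      ≡⟨ cong (λ e → elevation e ℤ.+ + rises w′) d≡ ⟩
    elevation (end c w) ℤ.+ + rises w′              ≡⟨ cong (ℤ._+ + rises w′) (elevation-end c w) ⟩
    elevation c ℤ.+ + rises w ℤ.+ + rises w′        ≡⟨ ℤ.+-assoc (elevation c) (+ rises w) (+ rises w′) ⟩
    elevation c ℤ.+ + (rises w ℕ.+ rises w′)        ∎
    where open ≡-Reasoning
  flat : rises w ℕ.+ rises w′ ≡ 0
  flat = ℤ.+-injective (sym (∙-cancelˡ (elevation c) 0ℤ _ (trans (ℤ.+-identityʳ _) loop)))
    where open AbelianGroup ℤ.+-0-abelianGroup using (∙-cancelˡ)
  powers : w ≡ w′
  powers with canonical-flat w w-can (ℕ.m+n≡0⇒m≡0 (rises w) flat) | canonical-flat w′ w′-can (ℕ.m+n≡0⇒n≡0 (rises w) flat)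
  ... | n , refl | n′ , refl = trans (cong (λ i → replicate i x⁺) (ℕ.m+n≡0⇒m≡0 n n+n′≡0))
    (sym (cong (λ i → replicate i x⁺) (ℕ.m+n≡0⇒n≡0 n n+n′≡0)))
    where
    c≡c⊕ : c ⊕ (+ (n ℕ.+ n′) , 0ℤ , 0ℤ) ≡ c ⊕ origin
    c≡c⊕ = begin
      c ⊕ ((+ n , 0ℤ , 0ℤ) ⊕ (+ n′ , 0ℤ , 0ℤ))   ≡⟨ ⊕-assoc c (+ n , 0ℤ , 0ℤ) (+ n′ , 0ℤ , 0ℤ) ⟨
      c ⊕ (+ n , 0ℤ , 0ℤ) ⊕ (+ n′ , 0ℤ , 0ℤ)     ≡⟨ cong (_⊕ (+ n′ , 0ℤ , 0ℤ)) (trans d≡ (end-x⁺ c n)) ⟨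
      d ⊕ (+ n′ , 0ℤ , 0ℤ)                       ≡⟨ trans c≡ (end-x⁺ d n′) ⟨
      c                                          ≡⟨ ⊕-identityʳ c ⟨
      c ⊕ origin                                 ∎
      where open ≡-Reasoning
    n+n′≡0 : n ℕ.+ n′ ≡ 0
    n+n′≡0 = ℤ.+-injective (cong proj₁ (⊕-cancelˡ c c≡c⊕))

-- Enumeration of words

next : State → List (Direction × State)
next free     = (x⁻ , run Sign.-) ∷ (x⁺ , run Sign.+) ∷ (y⁺ , free) ∷ (z⁺ , free) ∷ []
next (run s)  = (xdir s , run s) ∷ (y⁺ , rise s) ∷ (z⁺ , rise s) ∷ []
next (rise s) = (xdir s , run s) ∷ (y⁺ , free) ∷ (z⁺ , free) ∷ []

prefixed : (State → List (List Direction)) → List (Direction × State) → List (List Direction)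
prefixed ws = concatMap λ (s , τ) → map (s ∷_) (ws τ)

words : ℕ → State → List (List Direction)
words zero    _ = [ [] ]
words (suc n) σ = prefixed (words n) (next σ)

∈-prefixed⁺ : ∀ ws L {s τ w} → (s , τ) ∈ L → w ∈ ws τ → s ∷ w ∈ prefixed ws L
∈-prefixed⁺ ws (_ ∷ L) (here refl) w∈ = ∈-++⁺ˡ (∈-map⁺ _ w∈)
∈-prefixed⁺ ws (_ ∷ L) (there s∈)  w∈ = ∈-++⁺ʳ _ (∈-prefixed⁺ ws L s∈ w∈)

∈-prefixed⁻ : ∀ ws L {v} → v ∈ prefixed ws L → ∃[ s ] ∃[ τ ] ∃[ w ] v ≡ s ∷ w × (s , τ) ∈ L × w ∈ ws τ
∈-prefixed⁻ ws ((s , τ) ∷ L) v∈ with ∈-++⁻ (map (s ∷_) (ws τ)) v∈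
... | inj₁ v∈map with ∈-map⁻ (s ∷_) v∈map
...   | w , w∈ , refl = s , τ , w , refl , here refl , w∈
∈-prefixed⁻ ws ((s , τ) ∷ L) v∈ | inj₂ v∈rest with ∈-prefixed⁻ ws L v∈rest
... | t , υ , w , v≡ , t∈ , w∈ = t , υ , w , v≡ , there t∈ , w∈

unique-prefixed : ∀ ws → (∀ τ → Unique (ws τ)) → ∀ L → Unique (map proj₁ L) → Unique (prefixed ws L)
unique-prefixed ws uniques []            _              = []
unique-prefixed ws uniques ((s , τ) ∷ L) (s≢ ∷ unique) =
  Unique.++⁺ (Unique.map⁺ List.∷-injectiveʳ (uniques τ)) (unique-prefixed ws uniques L unique) disjoint
  where
  disjoint : ∀ {v} → ¬ (v ∈ map (s ∷_) (ws τ) × v ∈ prefixed ws L)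
  disjoint (v∈ , v∈′) with ∈-map⁻ (s ∷_) v∈ | ∈-prefixed⁻ ws L v∈′
  ... | _ , _ , refl | t , υ , w , refl , t∈ , _ = All.lookup s≢ (∈-map⁺ proj₁ t∈) refl

words-unique : ∀ n σ → Unique (words n σ)
words-unique zero    _ = [] ∷ []
words-unique (suc n) σ = unique-prefixed (words n) (words-unique n) (next σ) (distinct σ)
  where
  distinct : ∀ σ → Unique (map proj₁ (next σ))
  distinct free            = ((λ ()) ∷ (λ ()) ∷ (λ ()) ∷ []) ∷ ((λ ()) ∷ (λ ()) ∷ []) ∷ ((λ ()) ∷ []) ∷ [] ∷ []
  distinct (run Sign.+)    = ((λ ()) ∷ (λ ()) ∷ []) ∷ ((λ ()) ∷ []) ∷ [] ∷ []
  distinct (run Sign.-)    = ((λ ()) ∷ (λ ()) ∷ []) ∷ ((λ ()) ∷ []) ∷ [] ∷ []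
  distinct (rise Sign.+)   = ((λ ()) ∷ (λ ()) ∷ []) ∷ ((λ ()) ∷ []) ∷ [] ∷ []
  distinct (rise Sign.-)   = ((λ ()) ∷ (λ ()) ∷ []) ∷ ((λ ()) ∷ []) ∷ [] ∷ []

next⇒good : ∀ σ {s τ w} → (s , τ) ∈ next σ → Good τ w → Good σ (s ∷ w)
next⇒good free     (here refl)                         = across {s = Sign.-} free
next⇒good free     (there (here refl))                 = across {s = Sign.+} free
next⇒good free     (there (there (here refl)))         = up up-y
next⇒good free     (there (there (there (here refl)))) = up up-z
next⇒good (run s)  (here refl)                         = across run
next⇒good (run s)  (there (here refl))                 = up up-y
next⇒good (run s)  (there (there (here refl)))         = up up-z
next⇒good (rise s) (here refl)                         = across rise
next⇒good (rise s) (there (here refl))                 = up up-y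
next⇒good (rise s) (there (there (here refl)))         = up up-z

good⇒next : ∀ σ {s w} → Good σ (s ∷ w) → ∃[ τ ] (s , τ) ∈ next σ × Good τ w
good⇒next free     (across {Sign.-} free good) = _ , here refl , good
good⇒next free     (across {Sign.+} free good) = _ , there (here refl) , good
good⇒next free     (up up-y good)              = _ , there (there (here refl)) , good
good⇒next free     (up up-z good)              = _ , there (there (there (here refl))) , good
good⇒next (run s)  (across run good)           = _ , here refl , good
good⇒next (run s)  (up up-y good)              = _ , there (here refl) , good
good⇒next (run s)  (up up-z good)              = _ , there (there (here refl)) , good
good⇒next (rise s) (across rise good)          = _ , here refl , good
good⇒next (rise s) (up up-y good)              = _ , there (here refl) , good
good⇒next (rise s) (up up-z good)              = _ , there (there (here refl)) , good

∈-words⁺ : ∀ {σ} w → Good σ w → w ∈ words (length w) σ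
∈-words⁺ []      _    = here refl
∈-words⁺ {σ} (s ∷ w) good with good⇒next σ good
... | τ , s∈ , good′ = ∈-prefixed⁺ (words (length w)) (next σ) s∈ (∈-words⁺ w good′)

∈-words⁻ : ∀ n {σ w} → w ∈ words n σ → Good σ w × length w ≡ n
∈-words⁻ zero    (here refl) = [] , refl
∈-words⁻ (suc n) {σ} w∈ with ∈-prefixed⁻ (words n) (next σ) w∈
... | s , τ , w , refl , s∈ , w∈′ with ∈-words⁻ n w∈′
...   | good , length≡ = next⇒good σ s∈ good , cong suc length≡

words-run-head : ∀ n s → ∃[ ws ] words n (run s) ≡ replicate n (xdir s) ∷ ws
words-run-head zero    s = _ , refl
words-run-head (suc n) s rewrite proj₂ (words-run-head n s) = _ , refl

words-free-head : ∀ n → ∃[ ws ] words (suc n) free ≡ replicate (suc n) x⁻ ∷ ws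
words-free-head n rewrite proj₂ (words-run-head n Sign.-) = _ , refl

-- In length 0 the powers of x⁺ and of x⁻ coincide and nothing is dropped. This is why the closed
-- formula starts only at snakes with two cells.
canonicalWords : ℕ → List (List Direction)
canonicalWords zero    = [ [] ]
canonicalWords (suc n) = proj₁ (words-free-head n)

canonicalWords-unique : ∀ n → Unique (canonicalWords n)
canonicalWords-unique zero    = [] ∷ []
canonicalWords-unique (suc n) with subst Unique (proj₂ (words-free-head n)) (words-unique (suc n) free)
... | _ ∷ unique = unique

∈-canonicalWords⁺ : ∀ w → Canonical w → w ∈ canonicalWords (length w)
∈-canonicalWords⁺ []      _ = here refl
∈-canonicalWords⁺ (s ∷ w) (canonical good forwards)
  with subst (s ∷ w ∈_) (proj₂ (words-free-head (length w))) (∈-words⁺ (s ∷ w) good)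
... | here w≡  = ⊥-elim (forwards (length w) w≡)
... | there w∈ = w∈

∈-canonicalWords⁻ : ∀ n {w} → w ∈ canonicalWords n → Canonical w × length w ≡ n
∈-canonicalWords⁻ zero    (here refl) = canonical [] (λ _ ()) , refl
∈-canonicalWords⁻ (suc n) {w} w∈
  with ∈-words⁻ (suc n) (subst (w ∈_) (sym (proj₂ (words-free-head n))) (there w∈))
     | subst Unique (proj₂ (words-free-head n)) (words-unique (suc n) free)
... | good , length≡ | x⁻≢ ∷ _ = canonical good forwards , length≡
  where
  -- Since w has length suc n, it would be the dropped head once more, against uniqueness of the
  -- enumeration.
  forwards : ∀ k → w ≢ replicate (suc k) x⁻
  forwards k w≡ = All.lookup x⁻≢ w∈ (trans (cong (λ i → replicate i x⁻) (trans (sym length≡)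
    (trans (cong length w≡) (List.length-replicate (suc k))))) (sym w≡))

-- Counting

-- By mirror symmetry both signs share one count. The summands, with the final 0, are those of
-- `ℕ.sum` over `next`, which makes `length-words` hold by computation.
freeCount runCount riseCount : ℕ → ℕ
freeCount zero    = 1
freeCount (suc n) = runCount n ℕ.+ (runCount n ℕ.+ (freeCount n ℕ.+ (freeCount n ℕ.+ 0)))
runCount zero    = 1
runCount (suc n) = runCount n ℕ.+ (riseCount n ℕ.+ (riseCount n ℕ.+ 0))
riseCount zero    = 1
riseCount (suc n) = runCount n ℕ.+ (freeCount n ℕ.+ (freeCount n ℕ.+ 0))

count : ℕ → State → ℕ
count n free     = freeCount n
count n (run _)  = runCount n
count n (rise _) = riseCount n

length-words : ∀ n σ → length (words n σ) ≡ count n σ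
length-prefixed : ∀ n L → length (prefixed (words n) L) ≡ ℕ.sum (map (count n ∘ proj₂) L)

length-words zero    free     = refl
length-words zero    (run _)  = refl
length-words zero    (rise _) = refl
length-words (suc n) free     = length-prefixed n (next free)
length-words (suc n) (run s)  = length-prefixed n (next (run s))
length-words (suc n) (rise s) = length-prefixed n (next (rise s))

length-prefixed n []            = refl
length-prefixed n ((s , τ) ∷ L) = trans (List.length-++ (map (s ∷_) (words n τ)))
  (cong₂ ℕ._+_ (trans (List.length-map (s ∷_) (words n τ)) (length-words n τ)) (length-prefixed n L))

length-canonicalWords : ∀ n → suc (length (canonicalWords (suc n))) ≡ freeCount (suc n)
length-canonicalWords n = trans (cong length (sym (proj₂ (words-free-head n)))) (length-words (suc n) free)

-- The transition matrix of the automaton has characteristic polynomial λ³ - 3λ² - 4. The solver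
-- confirms this by unfolding three transitions.
freeCount-recurrence : ∀ n → freeCount (3 ℕ.+ n) ≡ 3 ℕ.* freeCount (2 ℕ.+ n) ℕ.+ 4 ℕ.* freeCount n
freeCount-recurrence n = solve 3 (λ f r p →
    let f₁ = r :+ (r :+ (f :+ (f :+ con 0)))
        r₁ = r :+ (p :+ (p :+ con 0))
        p₁ = r :+ (f :+ (f :+ con 0))
        f₂ = r₁ :+ (r₁ :+ (f₁ :+ (f₁ :+ con 0)))
        r₂ = r₁ :+ (p₁ :+ (p₁ :+ con 0))
    in r₂ :+ (r₂ :+ (f₂ :+ (f₂ :+ con 0))) := con 3 :* f₂ :+ con 4 :* f)
  refl (freeCount n) (runCount n) (riseCount n)
  where open ℕSolver.+-*-Solver

-- Snakes up to translation correspond to canonical words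

private
  module SetEq = Setoid ([ set ]-Equality Cell)

↭⇒∼set : ∀ {P Q : List Cell} → P ↭ Q → P ∼[ set ] Q
↭⇒∼set P↭Q = mk⇔ (∈-resp-↭ P↭Q) (∈-resp-↭ (↭-sym P↭Q))

linked⇒path : ∀ {c P} → Linked Step (c ∷ P) → ∃[ w ] c ∷ P ≡ path c w
linked⇒path [-] = [] , refl
linked⇒path {c} ((s , refl) ∷ linked) with linked⇒path linked
... | w , eq = s ∷ w , cong (c ∷_) eq

path-linked : ∀ c w → Linked Step (path c w)
path-linked c []      = [-]
path-linked c (s ∷ w) = (s , refl) ∷ path-linked (c ⊕ unitVector s) w

length-path : ∀ c w → length (path c w) ≡ suc (length w)
length-path c []      = refl
length-path c (s ∷ w) = cong suc (length-path (c ⊕ unitVector s) w)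

translate-path : ∀ t c w → map (t ⊕_) (path c w) ≡ path (t ⊕ c) w
translate-path t c []      = refl
translate-path t c (s ∷ w) = cong (t ⊕ c ∷_)
  (trans (translate-path t (c ⊕ unitVector s) w) (cong (λ e → path e w) (sym (⊕-assoc t c (unitVector s)))))

path-snoc : ∀ c n → path c (replicate (suc n) x⁺) ≡ path c (replicate n x⁺) ++ [ end c (replicate n x⁺) ⊕ unitVector x⁺ ]
path-snoc c zero    = refl
path-snoc c (suc n) = cong (c ∷_) (path-snoc (c ⊕ unitVector x⁺) n)

end-x⁻-x⁺ : ∀ c n → end (end c (replicate n x⁻)) (replicate n x⁺) ≡ c
end-x⁻-x⁺ c n = trans (end-x⁺ _ n) (back c n)
  where
  back : ∀ c n → end c (replicate n x⁻) ⊕ (+ n , 0ℤ , 0ℤ) ≡ c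
  back c zero    = ⊕-identityʳ c
  back c (suc n) = begin
    e ⊕ (unitVector x⁺ ⊕ (+ n , 0ℤ , 0ℤ))    ≡⟨ cong (e ⊕_) (⊕-comm (unitVector x⁺) (+ n , 0ℤ , 0ℤ)) ⟩
    e ⊕ ((+ n , 0ℤ , 0ℤ) ⊕ unitVector x⁺)    ≡⟨ ⊕-assoc e (+ n , 0ℤ , 0ℤ) (unitVector x⁺) ⟨
    e ⊕ (+ n , 0ℤ , 0ℤ) ⊕ unitVector x⁺      ≡⟨ cong (_⊕ unitVector x⁺) (back (c ⊕ unitVector x⁻) n) ⟩
    c ⊕ unitVector x⁻ ⊕ unitVector x⁺        ≡⟨ return c Sign.- Sign.+ (λ ()) ⟩
    c                                        ∎
    where
    open ≡-Reasoning
    e = end (c ⊕ unitVector x⁻) (replicate n x⁻)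

reverse-x⁻ : ∀ c n → path (end c (replicate n x⁻)) (replicate n x⁺) ↭ path c (replicate n x⁻)
reverse-x⁻ c zero    = ↭-refl
reverse-x⁻ c (suc n) = ↭-trans (↭-reflexive (trans (path-snoc e n) (cong (λ d → path e (replicate n x⁺) ++ [ d ])
    (trans (cong (_⊕ unitVector x⁺) (end-x⁻-x⁺ (c ⊕ unitVector x⁻) n)) (return c Sign.- Sign.+ (λ ()))))))
  (↭-trans (++-comm (path e (replicate n x⁺)) [ c ]) (prep c (reverse-x⁻ (c ⊕ unitVector x⁻) n)))
  where e = end (c ⊕ unitVector x⁻) (replicate n x⁻)

backwards? : ∀ w → Dec (w ≡ replicate (length w) x⁻)
backwards? []       = yes refl
backwards? (x⁺ ∷ w) = no λ ()
backwards? (y⁺ ∷ w) = no λ ()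
backwards? (z⁺ ∷ w) = no λ ()
backwards? (x⁻ ∷ w) with backwards? w
... | yes w≡ = yes (cong (x⁻ ∷_) w≡)
... | no  w≢ = no λ eq → w≢ (List.∷-injectiveʳ eq)

good-x⁺ : ∀ n → Good (run Sign.+) (replicate n x⁺)
good-x⁺ zero    = []
good-x⁺ (suc n) = across {s = Sign.+} run (good-x⁺ n)

canonical-x⁺ : ∀ n → Canonical (replicate n x⁺)
canonical-x⁺ zero    = canonical [] λ _ ()
canonical-x⁺ (suc n) = canonical (across {s = Sign.+} free (good-x⁺ n)) λ _ ()

-- The only good words that are not canonical are powers of x⁻, and such a power lists the same
-- cells as the power of x⁺ started at its other end.
canonicalise : ∀ c w → Good free w → ∃[ d ] ∃[ v ] Canonical v × length v ≡ length w × path d v ↭ path c w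
canonicalise c w good with backwards? w
... | yes w≡ = end c (replicate (length w) x⁻) , replicate (length w) x⁺ , canonical-x⁺ (length w) ,
  List.length-replicate (length w) , ↭-trans (reverse-x⁻ c (length w)) (↭-reflexive (cong (path c) (sym w≡)))
... | no w≢ = c , w , canonical good (λ n w≡ → w≢ (trans w≡ (cong (λ k → replicate k x⁻)
    (sym (trans (cong length w≡) (List.length-replicate (suc n))))))) , refl , ↭-refl

simple-↭ : ∀ {P Q} → P ↭ Q → IsSnake Q → Simple P
simple-↭ P↭Q snake = record
  { unique  = ↭ₛ.Unique-resp-↭ (≡.setoid Cell) (↭⇒↭ₛ (↭-sym P↭Q)) (IsSnake.unique snake)
  ; acyclic = λ cycle → IsSnake.acyclic snake record
    { Cycle cycle ; cells⊆P = All.map (∈-resp-↭ P↭Q) (Cycle.cells⊆P cycle) }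
  }

PDS⇒word : ∀ {n} (P : PDS (suc n)) → ∃[ w ] Canonical w × length w ≡ n × path origin w ≃ PDS.cells P
PDS⇒word P with PDS.partiallyDirected P | PDS.length≡n P
... | [] , []↭ , _ | length≡ with trans (↭-length []↭) length≡
...   | ()
PDS⇒word P | c ∷ _ , v↭ , linked | length≡ with linked⇒path linked
... | w , refl with canonicalise c w (simple⇒good-free c w (simple-↭ v↭ (PDS.isSnake P)))
...   | d , v , v-canonical , length-v , dv↭cw = v , v-canonical ,
  trans length-v (ℕ.suc-injective (trans (sym (length-path c w)) (trans (↭-length v↭) length≡))) ,
  d , SetEq.trans (SetEq.reflexive (trans (translate-path d origin v) (cong (λ e → path e v) (⊕-identityʳ d))))
        (↭⇒∼set (↭-trans dv↭cw v↭))

word⇒PDS : ∀ {n} w → Canonical w → length w ≡ n → PDS (suc n)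
word⇒PDS w w-canonical length≡ = record
  { cells             = path origin w
  ; isSnake           = induced⇒snake (good⇒induced origin w (Canonical.good w-canonical))
  ; partiallyDirected = path origin w , ↭-refl , path-linked origin w
  ; length≡n          = trans (length-path origin w) (cong suc length≡)
  }

lookup-injective : ∀ {A : Set} {xs : List A} → Unique xs → ∀ i j → lookup xs i ≡ lookup xs j → i ≡ j
lookup-injective (_ ∷ _)      zero    zero    _  = refl
lookup-injective (x≢ ∷ _)     zero    (suc j) eq = ⊥-elim (All.lookup x≢ (∈-lookup j) eq)
lookup-injective (x≢ ∷ _)     (suc i) zero    eq = ⊥-elim (All.lookup x≢ (∈-lookup i) (sym eq))
lookup-injective (_ ∷ unique) (suc i) (suc j) eq = cong suc (lookup-injective unique i j eq)

pds : ℕ → ℕ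
pds zero    = 1
pds (suc n) = length (canonicalWords n)

PDS-enumeration : ∀ n → Enumeration (pds n) (PDS-setoid n)
PDS-enumeration zero = record
  { to        = λ _ → record
    { cells = [] ; isSnake = induced⇒snake [] ; partiallyDirected = [] , ↭-refl , [] ; length≡n = refl }
  ; cong      = λ _ → ≃-refl {[]}
  ; bijective = (λ { {zero} {zero} _ → refl }) , λ P → zero , λ _ → empty (PDS.cells P) (PDS.length≡n P)
  }
  where
  empty : ∀ P → length P ≡ 0 → [] ≃ P
  empty [] _ = ≃-refl {[]}
PDS-enumeration (suc n) = record
  { to        = to-PDS
  ; cong      = λ { {i} refl → ≃-refl {path origin (word i)} }
  ; bijective = injective , surjective
  }
  where
  word : Fin (length (canonicalWords n)) → List Direction
  word = lookup (canonicalWords n)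
  word-canonical : ∀ i → Canonical (word i) × length (word i) ≡ n
  word-canonical i = ∈-canonicalWords⁻ n (∈-lookup i)
  to-PDS : Fin (length (canonicalWords n)) → PDS (suc n)
  to-PDS i = word⇒PDS (word i) (proj₁ (word-canonical i)) (proj₂ (word-canonical i))
  injective : ∀ {i j} → path origin (word i) ≃ path origin (word j) → i ≡ j
  injective {i} {j} (t , tP∼Q) = lookup-injective (canonicalWords-unique n) i j
    (same-set (t ⊕ origin) origin (word i) (word j) (proj₁ (word-canonical i)) (proj₁ (word-canonical j))
      (SetEq.trans (SetEq.reflexive (sym (translate-path t origin (word i)))) tP∼Q))
  surjective : ∀ P → ∃[ i ] (∀ {k} → k ≡ i → path origin (word k) ≃ PDS.cells P)
  surjective P with PDS⇒word {n} P
  ... | w , w-canonical , length≡ , w≃P = Any.index w∈ , λ { refl →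
      subst (λ v → path origin v ≃ PDS.cells P) (Any.lookup-index w∈) w≃P }
    where
    w∈ : w ∈ canonicalWords n
    w∈ = subst (λ k → w ∈ canonicalWords k) length≡ (∈-canonicalWords⁺ w w-canonical)

-- The generating function

-- Subtracting 1 from a solution of the cubic recurrence multiplies the characteristic polynomial by
-- λ - 1, and (λ - 1)(λ³ - 3λ² - 4) = λ⁴ - 4λ³ + 3λ² - 4λ + 4.
pds-recurrence : ∀ n → + pds (6 ℕ.+ n) ≡
  + 4 ℤ.* + pds (5 ℕ.+ n) ℤ.- + 3 ℤ.* + pds (4 ℕ.+ n) ℤ.+ + 4 ℤ.* + pds (3 ℕ.+ n) ℤ.- + 4 ℤ.* + pds (2 ℕ.+ n)
pds-recurrence n = begin
  + pds (6 ℕ.+ n)                    ≡⟨ pds≡ (4 ℕ.+ n) ⟩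
  f 4 ℤ.- + 1                        ≡⟨ cong (ℤ._- + 1) (f-rec (suc n)) ⟩
  + 3 ℤ.* f 3 ℤ.+ + 4 ℤ.* f 1 ℤ.- + 1
    ≡⟨ cong (λ u → + 3 ℤ.* u ℤ.+ + 4 ℤ.* f 1 ℤ.- + 1) (f-rec n) ⟩
  + 3 ℤ.* (+ 3 ℤ.* f 2 ℤ.+ + 4 ℤ.* f 0) ℤ.+ + 4 ℤ.* f 1 ℤ.- + 1
    ≡⟨ combine (f 0) (f 1) (f 2) ⟩
  + 4 ℤ.* (+ 3 ℤ.* f 2 ℤ.+ + 4 ℤ.* f 0 ℤ.- + 1) ℤ.- + 3 ℤ.* (f 2 ℤ.- + 1) ℤ.+ + 4 ℤ.* (f 1 ℤ.- + 1) ℤ.- + 4 ℤ.* (f 0 ℤ.- + 1)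
    ≡⟨ cong (λ u → + 4 ℤ.* (u ℤ.- + 1) ℤ.- + 3 ℤ.* (f 2 ℤ.- + 1) ℤ.+ + 4 ℤ.* (f 1 ℤ.- + 1) ℤ.- + 4 ℤ.* (f 0 ℤ.- + 1)) (f-rec n) ⟨
  + 4 ℤ.* (f 3 ℤ.- + 1) ℤ.- + 3 ℤ.* (f 2 ℤ.- + 1) ℤ.+ + 4 ℤ.* (f 1 ℤ.- + 1) ℤ.- + 4 ℤ.* (f 0 ℤ.- + 1)
    ≡⟨ cong₂ (λ u v → u ℤ.- + 4 ℤ.* v) (cong₂ (λ u v → u ℤ.+ + 4 ℤ.* v)
         (cong₂ (λ u v → + 4 ℤ.* u ℤ.- + 3 ℤ.* v) (pds≡ (3 ℕ.+ n)) (pds≡ (2 ℕ.+ n))) (pds≡ (1 ℕ.+ n))) (pds≡ n) ⟨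
  + 4 ℤ.* + pds (5 ℕ.+ n) ℤ.- + 3 ℤ.* + pds (4 ℕ.+ n) ℤ.+ + 4 ℤ.* + pds (3 ℕ.+ n) ℤ.- + 4 ℤ.* + pds (2 ℕ.+ n) ∎
  where
  open ≡-Reasoning
  f : ℕ → ℤ
  f k = + freeCount (suc (k ℕ.+ n))
  pds≡ : ∀ n → + pds (2 ℕ.+ n) ≡ + freeCount (suc n) ℤ.- + 1
  pds≡ n = cong (λ k → + k ℤ.- + 1) (length-canonicalWords n)
  f-rec : ∀ n → + freeCount (4 ℕ.+ n) ≡ + 3 ℤ.* + freeCount (3 ℕ.+ n) ℤ.+ + 4 ℤ.* + freeCount (1 ℕ.+ n)
  f-rec n = trans (cong +_ (freeCount-recurrence (suc n))) (cong₂ ℤ._+_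
    (ℤ.pos-* 3 (freeCount (3 ℕ.+ n))) (ℤ.pos-* 4 (freeCount (1 ℕ.+ n))))
  combine : ∀ a b c → + 3 ℤ.* (+ 3 ℤ.* c ℤ.+ + 4 ℤ.* a) ℤ.+ + 4 ℤ.* b ℤ.- + 1 ≡
    + 4 ℤ.* (+ 3 ℤ.* c ℤ.+ + 4 ℤ.* a ℤ.- + 1) ℤ.- + 3 ℤ.* (c ℤ.- + 1) ℤ.+ + 4 ℤ.* (b ℤ.- + 1) ℤ.- + 4 ℤ.* (a ℤ.- + 1)
  combine = solve-∀

-- The sum over three roots, in a commutative ring containing ℚ

/1-homo-+ : ∀ m n → + (m ℕ.+ n) / 1 ≡ (+ m / 1) ℚ.+ (+ n / 1)
/1-homo-+ m n = ℚ.toℚᵘ-injective (begin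
  ℚ.toℚᵘ (+ (m ℕ.+ n) / 1)                      ≈⟨ ℚ.toℚᵘ-fromℚᵘ (mkℚᵘ (+ (m ℕ.+ n)) 0) ⟩
  mkℚᵘ (+ (m ℕ.+ n)) 0                          ≈⟨ *≡* (cong₂ (λ p q → (p ℤ.+ q) ℤ.* + 1) (ℤ.*-identityʳ (+ m)) (ℤ.*-identityʳ (+ n))) ⟨
  mkℚᵘ (+ m) 0 ℚᵘ.+ mkℚᵘ (+ n) 0                ≈⟨ ℚᵘ.+-cong (ℚ.toℚᵘ-fromℚᵘ (mkℚᵘ (+ m) 0)) (ℚ.toℚᵘ-fromℚᵘ (mkℚᵘ (+ n) 0)) ⟨
  ℚ.toℚᵘ (+ m / 1) ℚᵘ.+ ℚ.toℚᵘ (+ n / 1)        ≈⟨ ℚ.toℚᵘ-homo-+ (+ m / 1) (+ n / 1) ⟨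
  ℚ.toℚᵘ (+ m / 1 ℚ.+ + n / 1)                  ∎)
  where open ℚᵘ.≃-Reasoning

/1-homo-* : ∀ m n → + (m ℕ.* n) / 1 ≡ (+ m / 1) ℚ.* (+ n / 1)
/1-homo-* m n = ℚ.toℚᵘ-injective (begin
  ℚ.toℚᵘ (+ (m ℕ.* n) / 1)                      ≈⟨ ℚ.toℚᵘ-fromℚᵘ (mkℚᵘ (+ (m ℕ.* n)) 0) ⟩
  mkℚᵘ (+ (m ℕ.* n)) 0                          ≈⟨ *≡* (cong (ℤ._* + 1) (sym (ℤ.pos-* m n))) ⟨
  mkℚᵘ (+ m) 0 ℚᵘ.* mkℚᵘ (+ n) 0                ≈⟨ ℚᵘ.*-cong (ℚ.toℚᵘ-fromℚᵘ (mkℚᵘ (+ m) 0)) (ℚ.toℚᵘ-fromℚᵘ (mkℚᵘ (+ n) 0)) ⟨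
  ℚ.toℚᵘ (+ m / 1) ℚᵘ.* ℚ.toℚᵘ (+ n / 1)        ≈⟨ ℚ.toℚᵘ-homo-* (+ m / 1) (+ n / 1) ⟨
  ℚ.toℚᵘ ((+ m / 1) ℚ.* (+ n / 1))                  ∎)
  where open ℚᵘ.≃-Reasoning

-- A record, so that two instances are compared operation by operation: unfolding
-- the formula to rational approximations is infeasible for the type checker.
record RootFormula
  {C : Set} (_≈_ : C → C → Set) (_+_ _-_ _*_ : C → C → C) (fromℚ : ℚ → C) (fromℕ : ℕ → C)
  (_^_ : C → ℕ → C) (∑ : (Fin 3 → C) → C) (b : Fin 3 → C) : Set where
  field
    formula : ∀ (f : ℕ → ℕ) → f 0 ≡ 1 → f 1 ≡ 4 → f 2 ≡ 14 →
      (∀ n → f (3 ℕ.+ n) ≡ 3 ℕ.* f (2 ℕ.+ n) ℕ.+ 4 ℕ.* f n) →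
      ∀ n k → f n ≡ suc k →
      fromℕ k ≈ ((fromℚ (+ 1 / 12) * ∑ (λ i → (b i + fromℕ 1) * (b i ^ suc n))) - fromℕ 1)

-- The values of Σ (β + 1) βⁿ; at n = 0 the sum is Σ β + 3 = 6.
scale : (ℕ → ℕ) → ℕ → ℕ
scale f zero    = 6
scale f (suc n) = 12 ℕ.* f n

-- The recurrence run backwards gives f the value 1/2 at index -1, from 14 = 3 · 4 + 4 · 1/2. Scaled
-- by 12 this is the 6 that the case n = 0 relies on.
scaled-recurrence : ∀ f → f 1 ≡ 4 → f 2 ≡ 14 →
  (∀ n → f (3 ℕ.+ n) ≡ 3 ℕ.* f (2 ℕ.+ n) ℕ.+ 4 ℕ.* f n) →
  ∀ n → scale f (3 ℕ.+ n) ≡ 3 ℕ.* scale f (2 ℕ.+ n) ℕ.+ 4 ℕ.* scale f n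
scaled-recurrence f f₁ f₂ f-rec zero rewrite f₁ | f₂ = refl
scaled-recurrence f f₁ f₂ f-rec (suc n) rewrite f-rec n =
  solve 2 (λ x y → con 12 :* (con 3 :* x :+ con 4 :* y) := con 3 :* (con 12 :* x) :+ con 4 :* (con 12 :* y))
    refl (f (2 ℕ.+ n)) (f n)
  where open ℕSolver.+-*-Solver

-- The morphism lets the solver normalise coefficients in ℚ, where equality is decidable, although
-- equality in R need not be.
module Cubic
  (R : CommutativeRing 0ℓ 0ℓ)
  (morphism : CommutativeRing.rawRing ℚ.+-*-commutativeRing -Raw-AlmostCommutative⟶ fromCommutativeRing R)
  where

  open CommutativeRing R hiding (zero) renaming (refl to ≈-refl; sym to ≈-sym; trans to ≈-trans)
  open _-Raw-AlmostCommutative⟶_ morphism using (+-homo; *-homo) renaming (⟦_⟧ to ι)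
  open Group +-group using (x∙y⁻¹≈ε⇒x≈y)
  open import Relation.Binary.Reasoning.Setoid setoid

  private
    ι-≟ : WeaklyDecidable (λ p q → ι p ≈ ι q)
    ι-≟ p q with p ℚ.≟ q
    ... | yes p≡q = just (reflexive (cong ι p≡q))
    ... | no  _   = nothing

  open Algebra.Solver.Ring (CommutativeRing.rawRing ℚ.+-*-commutativeRing) (fromCommutativeRing R) morphism ι-≟
    using (solve; _:=_; _:+_; _:*_; _:-_; :-_; con; Polynomial)

  x≈y⇒x-y≈0 : ∀ {x y} → x ≈ y → x - y ≈ 0#
  x≈y⇒x-y≈0 {x} {y} x≈y = ≈-trans (+-congʳ x≈y) (-‿inverseʳ y)

  *-vanish : ∀ c {x y} → x ≈ y → c * (x - y) ≈ 0#
  *-vanish c x≈y = ≈-trans (*-congˡ (x≈y⇒x-y≈0 x≈y)) (zeroʳ c)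

  +-vanish : ∀ {x y} → x ≈ 0# → y ≈ 0# → x + y ≈ 0#
  +-vanish x≈0 y≈0 = ≈-trans (+-cong x≈0 y≈0) (+-identityˡ 0#)

  -- The pattern for every identity modulo hypotheses: the solver writes p - q as a combination of
  -- differences that vanish by hypothesis, and the coefficients handed to `*-vanish` are the
  -- certificate.
  from-difference : ∀ {p q d} → d ≈ 0# → p - q ≈ d → p ≈ q
  from-difference {p} {q} d≈0 p-q≈d = x∙y⁻¹≈ε⇒x≈y p q (≈-trans p-q≈d d≈0)

  # : ℕ → Carrier
  # n = ι (+ n / 1)

  -- The cube is spelled as `α ^ 3` unfolds, so that over ℂ a `Root` is an `IsRoot` by definition.
  cubic : Carrier → Carrier
  cubic α = # 1 - # 3 * α - # 4 * (α * (α * (α * # 1)))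

  Root : Carrier → Set
  Root α = cubic α ≈ # 0

  private
    k : ∀ {m} → ℕ → Polynomial m
    k n = con (+ n / 1)
    :cubic : ∀ {m} → Polynomial m → Polynomial m
    :cubic α = k 1 :- k 3 :* α :- k 4 :* (α :* (α :* (α :* k 1)))
    :inverse : ∀ {m} → Polynomial m → Polynomial m
    :inverse α = k 4 :* (α :* α) :+ k 3

  x-y≈0⇒x≈y : ∀ {x y} → x - y ≈ # 0 → x ≈ y
  x-y≈0⇒x≈y {x} {y} x-y≈0 = from-difference (x≈y⇒x-y≈0 x-y≈0)
    (solve 2 (λ x y → x :- y := x :- y :- k 0) ≈-refl x y)

  *-rotate : ∀ x y z → x * (y * z) ≈ # 0 → y * (z * x) ≈ # 0
  *-rotate x y z = ≈-trans (≈-trans (≈-sym (*-assoc y z x)) (*-comm (y * z) x))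

  *-swap : ∀ x y z → x * (y * z) ≈ # 0 → x * (z * y) ≈ # 0
  *-swap x y z = ≈-trans (*-congˡ (*-comm z y))

  -- On a root 1 = α (4α² + 3), so the reciprocal is a polynomial in α and no division of complex
  -- numbers has to be constructed.
  inverse : Carrier → Carrier
  inverse α = # 4 * (α * α) + # 3

  *-inverse : ∀ {α} → Root α → α * inverse α ≈ # 1
  *-inverse {α} root = from-difference (*-vanish (- # 1) root)
    (solve 1 (λ α → α :* :inverse α :- k 1 := :- k 1 :* (:cubic α :- k 0)) ≈-refl α)

  inverse² : ∀ {α} → Root α → inverse α * inverse α ≈ # 4 * α + # 12 * (α * α) + # 9
  inverse² {α} root = from-difference (*-vanish (- (# 4 * α)) root)
    (solve 1 (λ α → :inverse α :* :inverse α :- (k 4 :* α :+ k 12 :* (α :* α) :+ k 9)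
      := :- (k 4 :* α) :* (:cubic α :- k 0)) ≈-refl α)

  -- Since β - 3 = 4α², the difference β³ - 3β² - 4 equals 4 ((αβ)² - 1), which contains the factor
  -- αβ - 1.
  inverse³ : ∀ {α} → Root α → let β = inverse α in β * (β * β) ≈ # 3 * (β * β) + # 4
  inverse³ {α} root = from-difference (*-vanish (# 4 * (α * inverse α + # 1)) (*-inverse root))
    (solve 1 (λ α → let β = :inverse α in
      β :* (β :* β) :- (k 3 :* (β :* β) :+ k 4) := k 4 :* (α :* β :+ k 1) :* (α :* β :- k 1)) ≈-refl α)

  #-homo-+ : ∀ m n → # (m ℕ.+ n) ≈ # m + # n
  #-homo-+ m n = ≈-trans (reflexive (cong ι (/1-homo-+ m n))) (+-homo (+ m / 1) (+ n / 1))

  #-homo-* : ∀ m n → # (m ℕ.* n) ≈ # m * # n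
  #-homo-* m n = ≈-trans (reflexive (cong ι (/1-homo-* m n))) (*-homo (+ m / 1) (+ n / 1))

  twelfth : ∀ {s} m → s ≈ # 12 * # (suc m) → # m ≈ ι (+ 1 / 12) * s - # 1
  twelfth {s} m s≈ = from-difference
    (+-vanish (*-vanish (- ι (+ 1 / 12)) s≈) (*-vanish (- # 1) (≈-trans (reflexive (cong # (ℕ.+-comm 1 m))) (#-homo-+ m 1))))
    (solve 3 (λ m m′ s → m :- (con (+ 1 / 12) :* s :- k 1)
      := :- con (+ 1 / 12) :* (s :- k 12 :* m′) :+ :- k 1 :* (m′ :- (m :+ k 1))) ≈-refl (# m) (# (suc m)) s)

  recurrence-unique : ∀ (s : ℕ → Carrier) (t : ℕ → ℕ) →
    s 0 ≈ # (t 0) → s 1 ≈ # (t 1) → s 2 ≈ # (t 2) →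
    (∀ n → s (3 ℕ.+ n) ≈ # 3 * s (2 ℕ.+ n) + # 4 * s n) →
    (∀ n → t (3 ℕ.+ n) ≡ 3 ℕ.* t (2 ℕ.+ n) ℕ.+ 4 ℕ.* t n) →
    ∀ n → s n ≈ # (t n)
  recurrence-unique s t s₀ s₁ s₂ s-rec t-rec = go
    where
    #-rec : ∀ n → # (t (3 ℕ.+ n)) ≈ # 3 * # (t (2 ℕ.+ n)) + # 4 * # (t n)
    #-rec n = ≈-trans (reflexive (cong # (t-rec n))) (≈-trans (#-homo-+ (3 ℕ.* t (2 ℕ.+ n)) (4 ℕ.* t n))
      (+-cong (#-homo-* 3 (t (2 ℕ.+ n))) (#-homo-* 4 (t n))))
    go : ∀ n → s n ≈ # (t n)
    go 0 = s₀
    go 1 = s₁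
    go 2 = s₂
    go (suc (suc (suc n))) = ≈-trans (s-rec n)
      (≈-trans (+-cong (*-congˡ (go (suc (suc n)))) (*-congˡ (go n))) (≈-sym (#-rec n)))

  -- The sum and the product are Vieta's relations for z² + α₀ z + α₀² + 3/4, which is the cubic
  -- divided by -4 (z - α₀). They yield both that α₁ and α₂ are roots and that the cubic splits into
  -- three linear factors.
  module ThreeRoots
    (α : Fin 3 → Carrier) (root₀ : Root (α zero))
    (sum≈0 : α zero + α (suc zero) + α (suc (suc zero)) ≈ # 0)
    (product : α (suc zero) * α (suc (suc zero)) ≈ α zero * α zero + ι (+ 3 / 4))
    where

    private
      α₀ = α zero
      α₁ = α (suc zero)
      α₂ = α (suc (suc zero))

      cubic-factored : ∀ z → let d = z - α₀ in
        cubic z - # 0 ≈ (cubic α₀ - # 0) + (- (# 4 * (z * d)) * (α₀ + α₁ + α₂ - # 0)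
          + # 4 * d * (α₁ * α₂ - (α₀ * α₀ + ι (+ 3 / 4)))) - # 4 * (d * ((z - α₁) * (z - α₂)))
      cubic-factored z = solve 4 (λ z a b c → let d = z :- a in
        :cubic z :- k 0 := (:cubic a :- k 0) :+ (:- (k 4 :* (z :* d)) :* (a :+ b :+ c :- k 0)
          :+ k 4 :* d :* (b :* c :- (a :* a :+ con (+ 3 / 4)))) :- k 4 :* (d :* ((z :- b) :* (z :- c))))
        ≈-refl z α₀ α₁ α₂

    root-of-factors : ∀ {z} → (z - α₀) * ((z - α₁) * (z - α₂)) ≈ # 0 → Root z
    root-of-factors {z} factors≈0 = from-difference
      (+-vanish (+-vanish (x≈y⇒x-y≈0 root₀) (+-vanish (*-vanish (- (# 4 * (z * (z - α₀)))) sum≈0) (*-vanish (# 4 * (z - α₀)) product)))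
        (*-vanish (- # 4) factors≈0))
      (≈-trans (cubic-factored z) (+-congˡ (solve 1 (λ q → :- (k 4 :* q) := :- k 4 :* (q :- k 0)) ≈-refl _)))

    root₁ : Root α₁
    root₁ = root-of-factors (solve 3 (λ a b c → (b :- a) :* ((b :- b) :* (b :- c)) := k 0) ≈-refl α₀ α₁ α₂)

    root₂ : Root α₂
    root₂ = root-of-factors (solve 3 (λ a b c → (c :- a) :* ((c :- b) :* (c :- c)) := k 0) ≈-refl α₀ α₁ α₂)

    factors : ∀ {z} → Root z → (z - α₀) * ((z - α₁) * (z - α₂)) ≈ # 0
    factors {z} root = from-difference
      (+-vanish (+-vanish (*-vanish (- (z * (z - α₀))) sum≈0) (*-vanish (z - α₀) product))
        (+-vanish (*-vanish (- ι (+ 1 / 4)) root) (*-vanish (ι (+ 1 / 4)) root₀)))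
      (solve 4 (λ z a b c →
        (z :- a) :* ((z :- b) :* (z :- c)) :- k 0
        := :- (z :* (z :- a)) :* (a :+ b :+ c :- k 0) :+ (z :- a) :* (b :* c :- (a :* a :+ con (+ 3 / 4)))
           :+ (:- con (+ 1 / 4) :* (:cubic z :- k 0) :+ con (+ 1 / 4) :* (:cubic a :- k 0)))
        ≈-refl z α₀ α₁ α₂)

    private
      β₀ = inverse α₀
      β₁ = inverse α₁
      β₂ = inverse α₂

    sum-squares : α₀ * α₀ + α₁ * α₁ + α₂ * α₂ ≈ - ι (+ 3 / 2)
    sum-squares = from-difference
      (+-vanish (*-vanish (α₁ + α₂ - α₀) sum≈0) (*-vanish (- # 2) product))
      (solve 3 (λ a b c →
        a :* a :+ b :* b :+ c :* c :- (:- con (+ 3 / 2))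
        := (b :+ c :- a) :* (a :+ b :+ c :- k 0) :+ :- k 2 :* (b :* c :- (a :* a :+ con (+ 3 / 4)))) ≈-refl α₀ α₁ α₂)

    sum-inverses : β₀ + β₁ + β₂ ≈ # 3
    sum-inverses = from-difference (*-vanish (# 4) sum-squares)
      (solve 3 (λ a b c → :inverse a :+ :inverse b :+ :inverse c :- k 3
        := k 4 :* (a :* a :+ b :* b :+ c :* c :- (:- con (+ 3 / 2)))) ≈-refl α₀ α₁ α₂)

    sum-inverse² : β₀ * β₀ + β₁ * β₁ + β₂ * β₂ ≈ # 9
    sum-inverse² = begin
      β₀ * β₀ + β₁ * β₁ + β₂ * β₂
        ≈⟨ +-cong (+-cong (inverse² root₀) (inverse² root₁)) (inverse² root₂) ⟩
      _ ≈⟨ from-difference (+-vanish (*-vanish (# 4) sum≈0) (*-vanish (# 12) sum-squares))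
             (solve 3 (λ a b c → let q = λ α → k 4 :* α :+ k 12 :* (α :* α) :+ k 9 in
               q a :+ q b :+ q c :- k 9
               := k 4 :* (a :+ b :+ c :- k 0) :+ k 12 :* (a :* a :+ b :* b :+ c :* c :- (:- con (+ 3 / 2))))
               ≈-refl α₀ α₁ α₂) ⟩
      # 9 ∎

    -- The powers are arguments, so that the recurrence becomes one polynomial identity; the last
    -- summand is the start of the fold in `∑`.
    weighted : Carrier → Carrier → Carrier → Carrier
    weighted p₀ p₁ p₂ = (β₀ + # 1) * p₀ + ((β₁ + # 1) * p₁ + ((β₂ + # 1) * p₂ + # 0))

    weighted-0 : weighted (# 1) (# 1) (# 1) ≈ # 6
    weighted-0 = from-difference (*-vanish (# 1) sum-inverses)
      (solve 3 (λ a b c →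
        (a :+ k 1) :* k 1 :+ ((b :+ k 1) :* k 1 :+ ((c :+ k 1) :* k 1 :+ k 0)) :- k 6
        := k 1 :* (a :+ b :+ c :- k 3)) ≈-refl β₀ β₁ β₂)

    weighted-1 : weighted (β₀ * # 1) (β₁ * # 1) (β₂ * # 1) ≈ # 12
    weighted-1 = from-difference
      (+-vanish (*-vanish (# 1) sum-inverses) (*-vanish (# 1) sum-inverse²))
      (solve 3 (λ a b c →
        (a :+ k 1) :* (a :* k 1) :+ ((b :+ k 1) :* (b :* k 1) :+ ((c :+ k 1) :* (c :* k 1) :+ k 0)) :- k 12
        := k 1 :* (a :+ b :+ c :- k 3) :+ k 1 :* (a :* a :+ b :* b :+ c :* c :- k 9)) ≈-refl β₀ β₁ β₂)

    weighted-2 : weighted (β₀ * (β₀ * # 1)) (β₁ * (β₁ * # 1)) (β₂ * (β₂ * # 1)) ≈ # 48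
    weighted-2 = from-difference
      (+-vanish (*-vanish (# 4) sum-inverse²) (+-vanish (*-vanish (# 1) (inverse³ root₀))
        (+-vanish (*-vanish (# 1) (inverse³ root₁)) (*-vanish (# 1) (inverse³ root₂)))))
      (solve 3 (λ a b c → let
          q = λ β → (β :+ k 1) :* (β :* (β :* k 1))
          r = λ β → k 1 :* (β :* (β :* β) :- (k 3 :* (β :* β) :+ k 4)) in
        q a :+ (q b :+ (q c :+ k 0)) :- k 48
        := k 4 :* (a :* a :+ b :* b :+ c :* c :- k 9) :+ (r a :+ (r b :+ r c))) ≈-refl β₀ β₁ β₂)

    weighted-recurrence : ∀ p₀ p₁ p₂ →
      weighted (β₀ * (β₀ * (β₀ * p₀))) (β₁ * (β₁ * (β₁ * p₁))) (β₂ * (β₂ * (β₂ * p₂))) ≈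
      # 3 * weighted (β₀ * (β₀ * p₀)) (β₁ * (β₁ * p₁)) (β₂ * (β₂ * p₂)) + # 4 * weighted p₀ p₁ p₂
    weighted-recurrence p₀ p₁ p₂ = from-difference
      (+-vanish (*-vanish ((β₀ + # 1) * p₀) (inverse³ root₀))
        (+-vanish (*-vanish ((β₁ + # 1) * p₁) (inverse³ root₁)) (*-vanish ((β₂ + # 1) * p₂) (inverse³ root₂))))
      (solve 6 (λ a b c p q r → let
          w = λ p q r → (a :+ k 1) :* p :+ ((b :+ k 1) :* q :+ ((c :+ k 1) :* r :+ k 0))
          d = λ β p → (β :+ k 1) :* p :* (β :* (β :* β) :- (k 3 :* (β :* β) :+ k 4)) in
        w (a :* (a :* (a :* p))) (b :* (b :* (b :* q))) (c :* (c :* (c :* r)))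
          :- (k 3 :* w (a :* (a :* p)) (b :* (b :* q)) (c :* (c :* r)) :+ k 4 :* w p q r)
        := d a p :+ (d b q :+ d c r)) ≈-refl β₀ β₁ β₂ p₀ p₁ p₂)

    weighted-cong : ∀ {p p′ q q′ r r′} → p ≈ p′ → q ≈ q′ → r ≈ r′ → weighted p q r ≈ weighted p′ q′ r′
    weighted-cong p≈ q≈ r≈ = +-cong (*-congˡ p≈) (+-cong (*-congˡ q≈) (+-congʳ (*-congˡ r≈)))

    module _
      (_^_ : Carrier → ℕ → Carrier) (^-zero : ∀ x → x ^ 0 ≈ # 1) (^-suc : ∀ x n → x ^ suc n ≈ x * (x ^ n))
      (_−_ : Carrier → Carrier → Carrier) (−≈- : ∀ x y → x − y ≈ x - y)
      (∑ : (Fin 3 → Carrier) → Carrier) (∑-sum : ∀ f → ∑ f ≈ f zero + (f (suc zero) + (f (suc (suc zero)) + # 0)))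
      where

      private
        power-sum : ℕ → Carrier
        power-sum n = ∑ (λ i → (inverse (α i) + # 1) * (inverse (α i) ^ n))

        power-sum≈ : ∀ n {p q r} → β₀ ^ n ≈ p → β₁ ^ n ≈ q → β₂ ^ n ≈ r → power-sum n ≈ weighted p q r
        power-sum≈ n p≈ q≈ r≈ = ≈-trans (∑-sum _) (weighted-cong p≈ q≈ r≈)

        ^-1 : ∀ x → x ^ 1 ≈ x * # 1
        ^-1 x = ≈-trans (^-suc x 0) (*-congˡ (^-zero x))

        ^-2 : ∀ x → x ^ 2 ≈ x * (x * # 1)
        ^-2 x = ≈-trans (^-suc x 1) (*-congˡ (^-1 x))

        ^-2+ : ∀ x n → x ^ suc (suc n) ≈ x * (x * (x ^ n))
        ^-2+ x n = ≈-trans (^-suc x (suc n)) (*-congˡ (^-suc x n))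

        ^-3+ : ∀ x n → x ^ suc (suc (suc n)) ≈ x * (x * (x * (x ^ n)))
        ^-3+ x n = ≈-trans (^-suc x (suc (suc n))) (*-congˡ (^-2+ x n))

        power-sum-recurrence : ∀ n → power-sum (3 ℕ.+ n) ≈ # 3 * power-sum (2 ℕ.+ n) + # 4 * power-sum n
        power-sum-recurrence n = begin
          power-sum (3 ℕ.+ n)
            ≈⟨ power-sum≈ (3 ℕ.+ n) (^-3+ β₀ n) (^-3+ β₁ n) (^-3+ β₂ n) ⟩
          weighted (β₀ * (β₀ * (β₀ * (β₀ ^ n)))) (β₁ * (β₁ * (β₁ * (β₁ ^ n)))) (β₂ * (β₂ * (β₂ * (β₂ ^ n))))
            ≈⟨ weighted-recurrence (β₀ ^ n) (β₁ ^ n) (β₂ ^ n) ⟩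
          # 3 * weighted (β₀ * (β₀ * (β₀ ^ n))) (β₁ * (β₁ * (β₁ ^ n))) (β₂ * (β₂ * (β₂ ^ n)))
            + # 4 * weighted (β₀ ^ n) (β₁ ^ n) (β₂ ^ n)
            ≈⟨ +-cong (*-congˡ (power-sum≈ (2 ℕ.+ n) (^-2+ β₀ n) (^-2+ β₁ n) (^-2+ β₂ n)))
                 (*-congˡ (power-sum≈ n ≈-refl ≈-refl ≈-refl)) ⟨
          # 3 * power-sum (2 ℕ.+ n) + # 4 * power-sum n ∎

      root-formula : RootFormula _≈_ _+_ _−_ _*_ ι # _^_ ∑ (λ i → inverse (α i))
      root-formula = record { formula = λ f f₀ f₁ f₂ f-rec n k fn≡ →
        ≈-trans (twelfth k (≈-trans (recurrence-unique power-sum (scale f)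
            (≈-trans (power-sum≈ 0 (^-zero β₀) (^-zero β₁) (^-zero β₂)) weighted-0)
            (≈-trans (power-sum≈ 1 (^-1 β₀) (^-1 β₁) (^-1 β₂))
              (≈-trans weighted-1 (reflexive (cong (λ m → # (12 ℕ.* m)) (≡.sym f₀)))))
            (≈-trans (power-sum≈ 2 (^-2 β₀) (^-2 β₁) (^-2 β₂))
              (≈-trans weighted-2 (reflexive (cong (λ m → # (12 ℕ.* m)) (≡.sym f₁)))))
            power-sum-recurrence (scaled-recurrence f f₁ f₂ f-rec) (suc n))
          (≈-trans (reflexive (cong (λ m → # (12 ℕ.* m)) fn≡)) (#-homo-* 12 (suc k))))) (≈-sym (−≈- _ _)) }

open import Defs
open import Data.Rational.Solver using (module +-*-Solver)
open +-*-Solver using (solve; _:=_; _:+_; _:*_; _:-_; :-_; con; Polynomial)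

open ℝ
open ℂ

-- The rings of real and of complex numbers

-- By definition x ≈ʳ y says that the differences of the approximations are `Null`, so equations
-- between reals become statements about null sequences of rationals.
Null : (ℕ → ℚ) → Set
Null a = ∀ ε → 0ℚ ℚ.< ε → EventuallyWithin ε a

null-cong : ∀ {a b} → a ≗ b → Null a → Null b
null-cong a≗b null ε 0<ε with null ε 0<ε
... | N , close = N , λ n N≤n → subst (λ u → ℚ.∣ u ∣ ℚ.< ε) (a≗b n) (close n N≤n)

null-+ : ∀ {a b} → Null a → Null b → Null (λ n → a n ℚ.+ b n)
null-+ {a} {b} null-a null-b ε 0<ε with null-a _ (half>0 0<ε) | null-b _ (half>0 0<ε)
... | M , closeM | N , closeN = M ℕ.⊔ N , λ n M⊔N≤n → within-+ (a n) (b n) refl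
  (closeM n (ℕ.m⊔n≤o⇒m≤o M N M⊔N≤n)) (closeN n (ℕ.m⊔n≤o⇒n≤o M N M⊔N≤n))

null-neg : ∀ {a} → Null a → Null (λ n → ℚ.- a n)
null-neg {a} null ε 0<ε with null ε 0<ε
... | N , close = N , λ n N≤n → subst (ℚ._< ε) (sym (ℚ.∣-p∣≡∣p∣ (a n))) (close n N≤n)

half<self : ∀ {ε} → 0ℚ ℚ.< ε → ½ ℚ.* ε ℚ.< ε
half<self {ε} 0<ε = begin-strict
  ½ ℚ.* ε                 ≡⟨ ℚ.+-identityʳ _ ⟨
  ½ ℚ.* ε ℚ.+ 0ℚ          <⟨ ℚ.+-monoʳ-< (½ ℚ.* ε) (half>0 0<ε) ⟩
  ½ ℚ.* ε ℚ.+ ½ ℚ.* ε     ≡⟨ halves ε ⟩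
  ε                       ∎
  where open ℚ.≤-Reasoning

null-* : ∀ x {a} → Null a → Null (λ n → approx x n ℚ.* a n)
null-* x {a} null ε 0<ε =
  let B , B>0 , M , x< = bounded x
      N , close = null (tolerance ε B B>0) (tolerance>0 B B>0 0<ε)
  in M ℕ.⊔ N , λ n M⊔N≤n → ℚ.<-trans
    (within-* {ε} B B>0 (approx x n) (a n)
      (x< n (ℕ.m⊔n≤o⇒m≤o M N M⊔N≤n)) (close n (ℕ.m⊔n≤o⇒n≤o M N M⊔N≤n)))
    (half<self 0<ε)

pointwise : ∀ {x y} → approx x ≗ approx y → x ≈ʳ y
pointwise {x} {y} x≗y = null-cong
  (λ n → trans (sym (ℚ.+-inverseʳ (approx y n))) (cong (ℚ._- approx y n) (sym (x≗y n))))
  (λ ε 0<ε → 0 , λ _ _ → 0<ε)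

pointwise-ℂ : ∀ {z w} → approx (re z) ≗ approx (re w) → approx (im z) ≗ approx (im w) → z ≈ w
pointwise-ℂ {z} {w} p q = pointwise {re z} {re w} p , pointwise {im z} {im w} q

+ʳ-cong : ∀ {x x′ y y′} → x ≈ʳ x′ → y ≈ʳ y′ → x +ʳ y ≈ʳ x′ +ʳ y′
+ʳ-cong {x} {x′} {y} {y′} x≈ y≈ = null-cong
  (λ n → sym (+-difference (approx x n) (approx x′ n) (approx y n) (approx y′ n))) (null-+ x≈ y≈)

-ʳ-cong : ∀ {x x′} → x ≈ʳ x′ → -ʳ x ≈ʳ -ʳ x′
-ʳ-cong {x} {x′} x≈ = null-cong
  (λ n → solve 2 (λ p q → :- (p :- q) := :- p :- :- q) refl (approx x n) (approx x′ n)) (null-neg x≈)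

*ʳ-cong : ∀ {x x′ y y′} → x ≈ʳ x′ → y ≈ʳ y′ → x *ʳ y ≈ʳ x′ *ʳ y′
*ʳ-cong {x} {x′} {y} {y′} x≈ y≈ = null-cong
  (λ n → sym (*-difference (approx x n) (approx x′ n) (approx y n) (approx y′ n)))
  (null-+ (null-* x y≈) (null-* y′ x≈))

ℂ-commutativeRing : CommutativeRing 0ℓ 0ℓ
ℂ-commutativeRing = record
  { Carrier = ℂ
  ; _≈_ = _≈_
  ; _+_ = _+_
  ; _*_ = _*_
  ; -_ = λ z → (-ʳ re z) +i (-ʳ im z)
  ; 0# = fromℕ 0
  ; 1# = fromℕ 1
  ; isCommutativeRing = record
    { isRing = record
      { +-isAbelianGroup = record
        { isGroup = record
          { isMonoid = record
            { isSemigroup = record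
              { isMagma = record
                { isEquivalence = record
                  { refl = λ {z} → ≈ʳ-refl {re z} , ≈ʳ-refl {im z}
                  ; sym = λ {z} {w} (p , q) → ≈ʳ-sym {re z} {re w} p , ≈ʳ-sym {im z} {im w} q
                  ; trans = λ {z} {w} {u} (p , q) (p′ , q′) →
                      ≈ʳ-trans {re z} {re w} {re u} p p′ , ≈ʳ-trans {im z} {im w} {im u} q q′
                  }
                ; ∙-cong = λ {z} {z′} {w} {w′} → +-cong {z} {z′} {w} {w′}
                }
              ; assoc = λ z w u → pointwise-ℂ {z + w + u} {z + (w + u)}
                  (λ n → ℚ.+-assoc (approx (re z) n) (approx (re w) n) (approx (re u) n))
                  (λ n → ℚ.+-assoc (approx (im z) n) (approx (im w) n) (approx (im u) n))
              }
            ; identity =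
                (λ z → pointwise-ℂ {fromℕ 0 + z} {z}
                  (λ n → ℚ.+-identityˡ (approx (re z) n)) (λ n → ℚ.+-identityˡ (approx (im z) n))) ,
                (λ z → pointwise-ℂ {z + fromℕ 0} {z}
                  (λ n → ℚ.+-identityʳ (approx (re z) n)) (λ n → ℚ.+-identityʳ (approx (im z) n)))
            }
          ; inverse =
              (λ z → pointwise-ℂ {((-ʳ re z) +i (-ʳ im z)) + z} {fromℕ 0}
                (λ n → ℚ.+-inverseˡ (approx (re z) n)) (λ n → ℚ.+-inverseˡ (approx (im z) n))) ,
              (λ z → pointwise-ℂ {z - z} {fromℕ 0}
                (λ n → ℚ.+-inverseʳ (approx (re z) n)) (λ n → ℚ.+-inverseʳ (approx (im z) n)))
          ; ⁻¹-cong = λ {z} {w} (p , q) → -ʳ-cong {re z} {re w} p , -ʳ-cong {im z} {im w} q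
          }
        ; comm = λ z w → pointwise-ℂ {z + w} {w + z}
            (λ n → ℚ.+-comm (approx (re z) n) (approx (re w) n))
            (λ n → ℚ.+-comm (approx (im z) n) (approx (im w) n))
        }
      ; *-cong = λ {z} {z′} {w} {w′} → *-cong {z} {z′} {w} {w′}
      ; *-assoc = λ z w u → pointwise-ℂ {z * w * u} {z * (w * u)}
          (λ n → solve 6 (λ a b c d e f →
              (a :* c :- b :* d) :* e :- (a :* d :+ b :* c) :* f
              := a :* (c :* e :- d :* f) :- b :* (c :* f :+ d :* e)) refl
            (approx (re z) n) (approx (im z) n) (approx (re w) n) (approx (im w) n) (approx (re u) n) (approx (im u) n))
          (λ n → solve 6 (λ a b c d e f →
              (a :* c :- b :* d) :* f :+ (a :* d :+ b :* c) :* e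
              := a :* (c :* f :+ d :* e) :+ b :* (c :* e :- d :* f)) refl
            (approx (re z) n) (approx (im z) n) (approx (re w) n) (approx (im w) n) (approx (re u) n) (approx (im u) n))
      ; *-identity = identityˡ , λ z → ≈-trans {z * fromℕ 1} {fromℕ 1 * z} {z} (*-comm z (fromℕ 1)) (identityˡ z)
      ; distrib = distribˡ , λ z w u → pointwise-ℂ {(w + u) * z} {w * z + u * z}
          (λ n → solve 6 (λ a b c d e f →
              (c :+ e) :* a :- (d :+ f) :* b := c :* a :- d :* b :+ (e :* a :- f :* b)) refl
            (approx (re z) n) (approx (im z) n) (approx (re w) n) (approx (im w) n) (approx (re u) n) (approx (im u) n))
          (λ n → solve 6 (λ a b c d e f →
              (c :+ e) :* b :+ (d :+ f) :* a := c :* b :+ d :* a :+ (e :* b :+ f :* a)) refl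
            (approx (re z) n) (approx (im z) n) (approx (re w) n) (approx (im w) n) (approx (re u) n) (approx (im u) n))
      }
    ; *-comm = *-comm
    }
  }
  where
  ≈-trans : ∀ {z w u} → z ≈ w → w ≈ u → z ≈ u
  ≈-trans {z} {w} {u} (p , q) (p′ , q′) =
    ≈ʳ-trans {re z} {re w} {re u} p p′ , ≈ʳ-trans {im z} {im w} {im u} q q′
  +-cong : ∀ {z z′ w w′} → z ≈ z′ → w ≈ w′ → z + w ≈ z′ + w′
  +-cong {z} {z′} {w} {w′} (p , q) (p′ , q′) =
    +ʳ-cong {re z} {re z′} {re w} {re w′} p p′ , +ʳ-cong {im z} {im z′} {im w} {im w′} q q′
  *-cong : ∀ {z z′ w w′} → z ≈ z′ → w ≈ w′ → z * w ≈ z′ * w′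
  *-cong {a +i b} {a′ +i b′} {c +i d} {c′ +i d′} (p , q) (p′ , q′) =
    +ʳ-cong {a *ʳ c} {a′ *ʳ c′} { -ʳ (b *ʳ d)} { -ʳ (b′ *ʳ d′)} (*ʳ-cong {a} {a′} {c} {c′} p p′)
      (-ʳ-cong {b *ʳ d} {b′ *ʳ d′} (*ʳ-cong {b} {b′} {d} {d′} q q′)) ,
    +ʳ-cong {a *ʳ d} {a′ *ʳ d′} {b *ʳ c} {b′ *ʳ c′} (*ʳ-cong {a} {a′} {d} {d′} p q′)
      (*ʳ-cong {b} {b′} {c} {c′} q p′)
  *-comm : ∀ z w → z * w ≈ w * z
  *-comm z w = pointwise-ℂ {z * w} {w * z}
    (λ n → solve 4 (λ a b c d → a :* c :- b :* d := c :* a :- d :* b) refl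
      (approx (re z) n) (approx (im z) n) (approx (re w) n) (approx (im w) n))
    (λ n → solve 4 (λ a b c d → a :* d :+ b :* c := c :* b :+ d :* a) refl
      (approx (re z) n) (approx (im z) n) (approx (re w) n) (approx (im w) n))
  identityˡ : ∀ z → fromℕ 1 * z ≈ z
  identityˡ z = pointwise-ℂ {fromℕ 1 * z} {z}
    (λ n → solve 2 (λ a b → con 1ℚ :* a :- con 0ℚ :* b := a) refl (approx (re z) n) (approx (im z) n))
    (λ n → solve 2 (λ a b → con 1ℚ :* b :+ con 0ℚ :* a := b) refl (approx (re z) n) (approx (im z) n))
  distribˡ : ∀ z w u → z * (w + u) ≈ z * w + z * u
  distribˡ z w u = pointwise-ℂ {z * (w + u)} {z * w + z * u}
    (λ n → solve 6 (λ a b c d e f →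
        a :* (c :+ e) :- b :* (d :+ f) := a :* c :- b :* d :+ (a :* e :- b :* f)) refl
      (approx (re z) n) (approx (im z) n) (approx (re w) n) (approx (im w) n) (approx (re u) n) (approx (im u) n))
    (λ n → solve 6 (λ a b c d e f →
        a :* (d :+ f) :+ b :* (c :+ e) := a :* d :+ b :* c :+ (a :* f :+ b :* e)) refl
      (approx (re z) n) (approx (im z) n) (approx (re w) n) (approx (im w) n) (approx (re u) n) (approx (im u) n))

-- Limits of contractions

/1-nonNeg : ∀ n → 0ℚ ℚ.≤ + n / 1
/1-nonNeg n = ℚ.nonNegative⁻¹ _ {{ℚ.normalize-nonNeg n 1}}

/1-mono-≤ : ∀ {m n} → m ℕ.≤ n → + m / 1 ℚ.≤ + n / 1
/1-mono-≤ {m} {n} m≤n = begin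
  + m / 1                          ≡⟨ ℚ.+-identityʳ _ ⟨
  + m / 1 ℚ.+ 0ℚ                   ≤⟨ ℚ.+-monoʳ-≤ (+ m / 1) (/1-nonNeg (n ℕ.∸ m)) ⟩
  + m / 1 ℚ.+ + (n ℕ.∸ m) / 1      ≡⟨ /1-homo-+ m (n ℕ.∸ m) ⟨
  + (m ℕ.+ (n ℕ.∸ m)) / 1          ≡⟨ cong (λ k → + k / 1) (ℕ.m+[n∸m]≡n m≤n) ⟩
  + n / 1                          ∎
  where open ℚ.≤-Reasoning

archimedean : ∀ ε → 0ℚ ℚ.< ε → ∃[ N ] 1ℚ ℚ.< + N / 1 ℚ.* ε
archimedean (mkℚ (+ zero) d _) (ℚ.*<* (ℤ.+<+ ()))
archimedean (mkℚ -[1+ _ ] d _) (ℚ.*<* ())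
archimedean ε@(mkℚ (+ suc p) d _) _ = N , ℚ.toℚᵘ-cancel-< (begin-strict
  ℚ.toℚᵘ 1ℚ                            <⟨ *<* (ℤ.+<+ bound) ⟩
  mkℚᵘ (+ N) 0 ℚᵘ.* mkℚᵘ (+ suc p) d   ≃⟨ ℚᵘ.*-congʳ (ℚᵘ.≃-sym (ℚ.toℚᵘ-fromℚᵘ (mkℚᵘ (+ N) 0))) ⟩
  ℚ.toℚᵘ (+ N / 1) ℚᵘ.* ℚ.toℚᵘ ε       ≃⟨ ℚ.toℚᵘ-homo-* (+ N / 1) ε ⟨
  ℚ.toℚᵘ (+ N / 1 ℚ.* ε)               ∎)
  where
  open ℚᵘ.≤-Reasoning
  -- ε has denominator suc d and a positive numerator, so it is at least 1 / suc d.
  N = suc (suc d)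
  bound : 1 ℕ.* suc (d ℕ.+ 0) ℕ.< N ℕ.* suc p ℕ.* 1
  bound = ℕ.≤-trans (ℕ.≤-reflexive (cong (λ k → suc (suc k)) (trans (ℕ.+-identityʳ _) (ℕ.+-identityʳ d))))
    (ℕ.≤-trans (ℕ.m≤m*n N (suc p)) (ℕ.≤-reflexive (sym (ℕ.*-identityʳ (N ℕ.* suc p)))))

-- The bound 1 / (n + 1) is weaker than geometric decay but suffices and avoids powers of 1/2. It is
-- preserved because n + 2 ≤ 2 (n + 1).
halving⇒null : ∀ b → ℚ.∣ b 0 ∣ ℚ.≤ 1ℚ → (∀ n → ℚ.∣ b (suc n) ∣ ℚ.≤ ½ ℚ.* ℚ.∣ b n ∣) → Null b
halving⇒null b base step ε 0<ε with archimedean ε 0<ε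
... | N , 1<Nε = N , λ n N≤n → ℚ.*-cancelˡ-<-nonNeg (+ suc n / 1) {{ℚ.normalize-nonNeg (suc n) 1}} (begin-strict
    (+ suc n / 1) ℚ.* ℚ.∣ b n ∣     ≤⟨ harmonic n ⟩
    1ℚ                              <⟨ 1<Nε ⟩
    (+ N / 1) ℚ.* ε                 ≤⟨ ℚ.*-monoʳ-≤-nonNeg ε {{ℚ.nonNegative (ℚ.<⇒≤ 0<ε)}} (/1-mono-≤ (ℕ.m≤n⇒m≤1+n N≤n)) ⟩
    (+ suc n / 1) ℚ.* ε             ∎)
  where
  open ℚ.≤-Reasoning
  harmonic : ∀ n → (+ suc n / 1) ℚ.* ℚ.∣ b n ∣ ℚ.≤ 1ℚ
  harmonic zero    = ℚ.≤-trans (ℚ.≤-reflexive (ℚ.*-identityˡ ℚ.∣ b 0 ∣)) base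
  harmonic (suc n) = begin
    (+ suc (suc n) / 1) ℚ.* ℚ.∣ b (suc n) ∣
      ≤⟨ ℚ.*-monoˡ-≤-nonNeg (+ suc (suc n) / 1) {{ℚ.normalize-nonNeg (suc (suc n)) 1}} (step n) ⟩
    (+ suc (suc n) / 1) ℚ.* (½ ℚ.* ℚ.∣ b n ∣)
      ≤⟨ ℚ.*-monoʳ-≤-nonNeg (½ ℚ.* ℚ.∣ b n ∣) {{ℚ.nonNeg*nonNeg⇒nonNeg ½ ℚ.∣ b n ∣ {{ℚ.∣-∣-nonNeg (b n)}}}}
           (/1-mono-≤ (ℕ.s≤s (ℕ.m≤n+m (suc n) n))) ⟩
    (+ (suc n ℕ.+ suc n) / 1) ℚ.* (½ ℚ.* ℚ.∣ b n ∣)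
      ≡⟨ cong (ℚ._* (½ ℚ.* ℚ.∣ b n ∣)) (/1-homo-+ (suc n) (suc n)) ⟩
    ((+ suc n / 1) ℚ.+ (+ suc n / 1)) ℚ.* (½ ℚ.* ℚ.∣ b n ∣)
      ≡⟨ solve 2 (λ k c → (k :+ k) :* (con ½ :* c) := k :* c) refl (+ suc n / 1) ℚ.∣ b n ∣ ⟩
    (+ suc n / 1) ℚ.* ℚ.∣ b n ∣
      ≤⟨ harmonic n ⟩
    1ℚ ∎

nonNeg-+ : ∀ {p q} → 0ℚ ℚ.≤ p → 0ℚ ℚ.≤ q → 0ℚ ℚ.≤ p ℚ.+ q
nonNeg-+ = ℚ.+-mono-≤

nonNeg-* : ∀ {p q} → 0ℚ ℚ.≤ p → 0ℚ ℚ.≤ q → 0ℚ ℚ.≤ p ℚ.* q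
nonNeg-* {p} {q} 0≤p 0≤q = ℚ.nonNegative⁻¹ _
  {{ℚ.nonNeg*nonNeg⇒nonNeg p {{ℚ.nonNegative 0≤p}} q {{ℚ.nonNegative 0≤q}}}}

≤-by : ∀ {p q} r → 0ℚ ℚ.≤ r → q ≡ p ℚ.+ r → p ℚ.≤ q
≤-by {p} r 0≤r refl = ℚ.≤-trans (ℚ.≤-reflexive (sym (ℚ.+-identityʳ p))) (ℚ.+-monoʳ-≤ p 0≤r)

∣-∣-≤ : ∀ {p q} → 0ℚ ℚ.≤ q ℚ.- p → 0ℚ ℚ.≤ q ℚ.+ p → ℚ.∣ p ∣ ℚ.≤ q
∣-∣-≤ {p} {q} 0≤q-p 0≤q+p with ℚ.∣p∣≡p∨∣p∣≡-p p
... | inj₁ ∣p∣≡p  = ℚ.≤-trans (ℚ.≤-reflexive ∣p∣≡p)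
  (≤-by (q ℚ.- p) 0≤q-p (solve 2 (λ p q → q := p :+ (q :- p)) refl p q))
... | inj₂ ∣p∣≡-p = ℚ.≤-trans (ℚ.≤-reflexive ∣p∣≡-p)
  (≤-by (q ℚ.+ p) 0≤q+p (solve 2 (λ p q → q := :- p :+ (q :+ p)) refl p q))

-- The upper bound is stored as a nonnegative slack, the form that `nonNeg-+` and `nonNeg-*`
-- consume.
InHalf : ℚ → Set
InHalf x = 0ℚ ℚ.≤ x × 0ℚ ℚ.≤ ½ ℚ.- x

-- The residuals F (iterate n) at least halve at each step, and F expands
-- distances, so the iterates are Cauchy.
module FixedPoint
  (F φ κ : ℚ → ℚ) (μ : ℚ → ℚ → ℚ)
  (φ-in   : ∀ {x} → InHalf x → InHalf (φ x))
  (F-φ    : ∀ x → F (φ x) ≡ κ x ℚ.* F x)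
  (∣κ∣≤½  : ∀ {x} → InHalf x → ℚ.∣ κ x ∣ ℚ.≤ ½)
  (F-diff : ∀ x y → F x ℚ.- F y ≡ μ x y ℚ.* (x ℚ.- y))
  (1≤∣μ∣  : ∀ {x y} → InHalf x → InHalf y → 1ℚ ℚ.≤ ℚ.∣ μ x y ∣)
  (∣F0∣≤1 : ℚ.∣ F 0ℚ ∣ ℚ.≤ 1ℚ)
  where

  open ℚ.≤-Reasoning

  iterate : ℕ → ℚ
  iterate zero    = 0ℚ
  iterate (suc n) = φ (iterate n)

  iterate-in : ∀ n → InHalf (iterate n)
  iterate-in zero    = ℚ.≤-refl , ℚ.nonNegative⁻¹ _
  iterate-in (suc n) = φ-in (iterate-in n)

  residual-null : Null (λ n → F (iterate n))
  residual-null = halving⇒null (λ n → F (iterate n)) ∣F0∣≤1 λ n → begin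
    ℚ.∣ F (φ (iterate n)) ∣                      ≡⟨ cong ℚ.∣_∣ (F-φ (iterate n)) ⟩
    ℚ.∣ κ (iterate n) ℚ.* F (iterate n) ∣        ≡⟨ ℚ.∣p*q∣≡∣p∣*∣q∣ (κ (iterate n)) (F (iterate n)) ⟩
    ℚ.∣ κ (iterate n) ∣ ℚ.* ℚ.∣ F (iterate n) ∣  ≤⟨ ℚ.*-monoʳ-≤-nonNeg _ {{ℚ.∣-∣-nonNeg (F (iterate n))}} (∣κ∣≤½ (iterate-in n)) ⟩
    ½ ℚ.* ℚ.∣ F (iterate n) ∣                    ∎

  expanding : ∀ {x y} → InHalf x → InHalf y → ℚ.∣ x ℚ.- y ∣ ℚ.≤ ℚ.∣ F x ℚ.- F y ∣
  expanding {x} {y} x∈ y∈ = begin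
    ℚ.∣ x ℚ.- y ∣                     ≡⟨ ℚ.*-identityˡ _ ⟨
    1ℚ ℚ.* ℚ.∣ x ℚ.- y ∣              ≤⟨ ℚ.*-monoʳ-≤-nonNeg _ {{ℚ.∣-∣-nonNeg (x ℚ.- y)}} (1≤∣μ∣ x∈ y∈) ⟩
    ℚ.∣ μ x y ∣ ℚ.* ℚ.∣ x ℚ.- y ∣     ≡⟨ ℚ.∣p*q∣≡∣p∣*∣q∣ (μ x y) (x ℚ.- y) ⟨
    ℚ.∣ μ x y ℚ.* (x ℚ.- y) ∣         ≡⟨ cong ℚ.∣_∣ (F-diff x y) ⟨
    ℚ.∣ F x ℚ.- F y ∣                 ∎

  limit : ℝ
  limit = mkℝ iterate λ ε 0<ε → let N , close = residual-null _ (half>0 0<ε) in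
    N , λ m n N≤m N≤n → ℚ.≤-<-trans (expanding (iterate-in m) (iterate-in n))
      (within-+ {ε} (F (iterate m)) (ℚ.- F (iterate n)) refl (close m N≤m)
        (subst (ℚ._< ½ ℚ.* ε) (sym (ℚ.∣-p∣≡∣p∣ (F (iterate n)))) (close n N≤n)))

-- Contractions towards the real root of the cubic and the square root of 3/2

1≤∣1+p∣ : ∀ {p q} → 0ℚ ℚ.≤ p → q ≡ 1ℚ ℚ.+ p → 1ℚ ℚ.≤ ℚ.∣ q ∣
1≤∣1+p∣ {p} 0≤p q≡1+p = ℚ.≤-trans 1≤q (ℚ.≤-reflexive (sym (ℚ.0≤p⇒∣p∣≡p (ℚ.≤-trans (ℚ.nonNegative⁻¹ 1ℚ) 1≤q))))
  where 1≤q = ≤-by p 0≤p q≡1+p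

private
  -- Inequalities are certified by rewriting their slack as a sum of products of nonnegative terms.
  by-slack : ∀ {p q} → 0ℚ ℚ.≤ p → q ≡ p → 0ℚ ℚ.≤ q
  by-slack 0≤p refl = 0≤p
  :cubic : ∀ {n} → Polynomial n → Polynomial n
  :cubic x = con (+ 4 / 1) :* (x :* (x :* x)) :+ con (+ 3 / 1) :* x :- con 1ℚ
  :cubic-step : ∀ {n} → Polynomial n → Polynomial n
  :cubic-step x = con (+ 1 / 4) :* (con 1ℚ :+ x :- con (+ 4 / 1) :* (x :* (x :* x)))
  :square : ∀ {n} → Polynomial n → Polynomial n
  :square x = x :* x :+ con (+ 2 / 1) :* x :- con ½
  :square-step : ∀ {n} → Polynomial n → Polynomial n
  :square-step x = con (+ 1 / 4) :- con ½ :* (x :* x)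

-- cubic-step x = x - cubicℚ x / 4
cubicℚ cubic-step cubic-factor : ℚ → ℚ
cubicℚ x       = (+ 4 / 1) ℚ.* (x ℚ.* (x ℚ.* x)) ℚ.+ (+ 3 / 1) ℚ.* x ℚ.- 1ℚ
cubic-step x   = (+ 1 / 4) ℚ.* (1ℚ ℚ.+ x ℚ.- (+ 4 / 1) ℚ.* (x ℚ.* (x ℚ.* x)))
cubic-factor x = (+ 1 / 4) ℚ.- (x ℚ.* x ℚ.+ x ℚ.* cubic-step x ℚ.+ cubic-step x ℚ.* cubic-step x)

cubic-slope : ℚ → ℚ → ℚ
cubic-slope x y = (+ 4 / 1) ℚ.* (x ℚ.* x ℚ.+ x ℚ.* y ℚ.+ y ℚ.* y) ℚ.+ (+ 3 / 1)

-- squareℚ x = (1 + x)² - 3/2 and square-step x = x - squareℚ x / 2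
squareℚ square-step square-factor : ℚ → ℚ
squareℚ x       = x ℚ.* x ℚ.+ (+ 2 / 1) ℚ.* x ℚ.- ½
square-step x   = (+ 1 / 4) ℚ.- ½ ℚ.* (x ℚ.* x)
square-factor x = ℚ.- (½ ℚ.* (x ℚ.+ square-step x))

square-slope : ℚ → ℚ → ℚ
square-slope x y = x ℚ.+ y ℚ.+ (+ 2 / 1)

cubic-step-in : ∀ {x} → InHalf x → InHalf (cubic-step x)
cubic-step-in {x} (0≤x , 0≤s) =
  by-slack {(+ 1 / 4) ℚ.+ x ℚ.* ((½ ℚ.- x) ℚ.* (½ ℚ.+ x))}
    (nonNeg-+ (ℚ.nonNegative⁻¹ (+ 1 / 4)) (nonNeg-* 0≤x (nonNeg-* 0≤s (nonNeg-+ (ℚ.nonNegative⁻¹ ½) 0≤x))))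
    (solve 1 (λ x → :cubic-step x := con (+ 1 / 4) :+ x :* ((con ½ :- x) :* (con ½ :+ x))) refl x) ,
  by-slack {(+ 1 / 4) ℚ.* (½ ℚ.+ (½ ℚ.- x)) ℚ.+ x ℚ.* (x ℚ.* x)}
    (nonNeg-+ (nonNeg-* (ℚ.nonNegative⁻¹ (+ 1 / 4)) (nonNeg-+ (ℚ.nonNegative⁻¹ ½) 0≤s)) (nonNeg-* 0≤x (nonNeg-* 0≤x 0≤x)))
    (solve 1 (λ x → con ½ :- :cubic-step x := con (+ 1 / 4) :* (con ½ :+ (con ½ :- x)) :+ x :* (x :* x)) refl x)

square-step-in : ∀ {x} → InHalf x → InHalf (square-step x)
square-step-in {x} (0≤x , 0≤s) =
  by-slack {½ ℚ.* ((+ 1 / 4) ℚ.+ (½ ℚ.- x) ℚ.* (½ ℚ.+ x))}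
    (nonNeg-* (ℚ.nonNegative⁻¹ ½) (nonNeg-+ (ℚ.nonNegative⁻¹ (+ 1 / 4)) (nonNeg-* 0≤s (nonNeg-+ (ℚ.nonNegative⁻¹ ½) 0≤x))))
    (solve 1 (λ x → :square-step x := con ½ :* (con (+ 1 / 4) :+ (con ½ :- x) :* (con ½ :+ x))) refl x) ,
  by-slack {(+ 1 / 4) ℚ.+ ½ ℚ.* (x ℚ.* x)}
    (nonNeg-+ (ℚ.nonNegative⁻¹ (+ 1 / 4)) (nonNeg-* (ℚ.nonNegative⁻¹ ½) (nonNeg-* 0≤x 0≤x)))
    (solve 1 (λ x → con ½ :- :square-step x := con (+ 1 / 4) :+ con ½ :* (x :* x)) refl x)

-- As y = `cubic-step x` differs from x by a quarter of the residual, the residual at y is 1 -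
-- `cubic-slope x y` / 4 times the one at x, and this factor is 1/4 - (x² + xy + y²).
cubic-factored : ∀ x → cubicℚ (cubic-step x) ≡ cubic-factor x ℚ.* cubicℚ x
cubic-factored = solve 1 (λ x → let y = :cubic-step x in
  :cubic y := (con (+ 1 / 4) :- (x :* x :+ x :* y :+ y :* y)) :* :cubic x) refl

-- For x and y in [0, 1/2] the sum x² + xy + y² lies in [0, 3/4], so the factor lies in [-1/2, 1/4].
cubic-factor≤½ : ∀ {x} → InHalf x → ℚ.∣ cubic-factor x ∣ ℚ.≤ ½
cubic-factor≤½ {x} x∈@(0≤x , 0≤½-x) = ∣-∣-≤
  (by-slack (nonNeg-+ (ℚ.nonNegative⁻¹ (+ 1 / 4))
      (nonNeg-+ (nonNeg-+ (nonNeg-* 0≤x 0≤x) (nonNeg-* 0≤x 0≤y)) (nonNeg-* 0≤y 0≤y)))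
    (solve 2 (λ x y → con ½ :- (con (+ 1 / 4) :- (x :* x :+ x :* y :+ y :* y))
      := con (+ 1 / 4) :+ (x :* x :+ x :* y :+ y :* y)) refl x (cubic-step x)))
  (by-slack (nonNeg-+ (nonNeg-+ (nonNeg-* 0≤½-x (nonNeg-+ 0≤½ 0≤x))
      (nonNeg-+ (nonNeg-* 0≤½ 0≤½-x) (nonNeg-* 0≤x 0≤½-y))) (nonNeg-* 0≤½-y (nonNeg-+ 0≤½ 0≤y)))
    (solve 2 (λ x y → con ½ :+ (con (+ 1 / 4) :- (x :* x :+ x :* y :+ y :* y))
      := ((con ½ :- x) :* (con ½ :+ x) :+ (con ½ :* (con ½ :- x) :+ x :* (con ½ :- y)))
         :+ (con ½ :- y) :* (con ½ :+ y)) refl x (cubic-step x)))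
  where
  0≤½   = ℚ.nonNegative⁻¹ ½
  0≤y   = proj₁ (cubic-step-in x∈)
  0≤½-y = proj₂ (cubic-step-in x∈)

cubic-difference : ∀ x y → cubicℚ x ℚ.- cubicℚ y ≡ cubic-slope x y ℚ.* (x ℚ.- y)
cubic-difference = solve 2 (λ x y → :cubic x :- :cubic y
  := (con (+ 4 / 1) :* (x :* x :+ x :* y :+ y :* y) :+ con (+ 3 / 1)) :* (x :- y)) refl

1≤cubic-slope : ∀ {x y} → InHalf x → InHalf y → 1ℚ ℚ.≤ ℚ.∣ cubic-slope x y ∣
1≤cubic-slope {x} {y} (0≤x , _) (0≤y , _) = 1≤∣1+p∣
  (nonNeg-+ (nonNeg-* (ℚ.nonNegative⁻¹ (+ 4 / 1))
    (nonNeg-+ (nonNeg-+ (nonNeg-* 0≤x 0≤x) (nonNeg-* 0≤x 0≤y)) (nonNeg-* 0≤y 0≤y))) (ℚ.nonNegative⁻¹ (+ 2 / 1)))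
  (solve 2 (λ x y → con (+ 4 / 1) :* (x :* x :+ x :* y :+ y :* y) :+ con (+ 3 / 1)
    := con 1ℚ :+ (con (+ 4 / 1) :* (x :* x :+ x :* y :+ y :* y) :+ con (+ 2 / 1))) refl x y)

module CubicRoot = FixedPoint cubicℚ cubic-step cubic-factor cubic-slope
  cubic-step-in cubic-factored cubic-factor≤½ cubic-difference 1≤cubic-slope ℚ.≤-refl

square-factored : ∀ x → squareℚ (square-step x) ≡ square-factor x ℚ.* squareℚ x
square-factored = solve 1 (λ x → let y = :square-step x in :square y := :- (con ½ :* (x :+ y)) :* :square x) refl

square-factor≤½ : ∀ {x} → InHalf x → ℚ.∣ square-factor x ∣ ℚ.≤ ½
square-factor≤½ {x} x∈@(0≤x , 0≤½-x) = ∣-∣-≤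
  (by-slack (nonNeg-+ 0≤½ (nonNeg-* 0≤½ (nonNeg-+ 0≤x (proj₁ (square-step-in x∈)))))
    (solve 2 (λ x y → con ½ :- (:- (con ½ :* (x :+ y))) := con ½ :+ con ½ :* (x :+ y)) refl x (square-step x)))
  (by-slack (nonNeg-* 0≤½ (nonNeg-+ 0≤½-x (proj₂ (square-step-in x∈))))
    (solve 2 (λ x y → con ½ :+ :- (con ½ :* (x :+ y)) := con ½ :* ((con ½ :- x) :+ (con ½ :- y))) refl x (square-step x)))
  where 0≤½ = ℚ.nonNegative⁻¹ ½

square-difference : ∀ x y → squareℚ x ℚ.- squareℚ y ≡ square-slope x y ℚ.* (x ℚ.- y)
square-difference = solve 2 (λ x y → :square x :- :square y := (x :+ y :+ con (+ 2 / 1)) :* (x :- y)) refl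

1≤square-slope : ∀ {x y} → InHalf x → InHalf y → 1ℚ ℚ.≤ ℚ.∣ square-slope x y ∣
1≤square-slope {x} {y} (0≤x , _) (0≤y , _) = 1≤∣1+p∣ (nonNeg-+ (nonNeg-+ 0≤x 0≤y) (ℚ.nonNegative⁻¹ 1ℚ))
  (solve 2 (λ x y → x :+ y :+ con (+ 2 / 1) := con 1ℚ :+ (x :+ y :+ con 1ℚ)) refl x y)

∣square-0∣≤1 : ℚ.∣ squareℚ 0ℚ ∣ ℚ.≤ 1ℚ
∣square-0∣≤1 = ≤-by ½ (ℚ.nonNegative⁻¹ ½) refl

module SquareRoot = FixedPoint squareℚ square-step square-factor square-slope
  square-step-in square-factored square-factor≤½ square-difference 1≤square-slope ∣square-0∣≤1

-- The roots

fromℚ-morphism : CommutativeRing.rawRing ℚ.+-*-commutativeRing -Raw-AlmostCommutative⟶ fromCommutativeRing ℂ-commutativeRing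
fromℚ-morphism = record
  { ⟦_⟧    = fromℚ
  ; +-homo = λ p q → pointwise-ℂ {fromℚ (p ℚ.+ q)} {fromℚ p + fromℚ q} (λ _ → refl) (λ _ → refl)
  ; *-homo = λ p q → pointwise-ℂ {fromℚ (p ℚ.* q)} {fromℚ p * fromℚ q}
      (λ _ → solve 2 (λ p q → p :* q := p :* q :- con 0ℚ :* con 0ℚ) refl p q)
      (λ _ → solve 2 (λ p q → con 0ℚ := p :* con 0ℚ :+ con 0ℚ :* q) refl p q)
  ; -‿homo = λ p → pointwise-ℂ {fromℚ (ℚ.- p)} {(-ʳ fromℚʳ p) +i (-ʳ fromℚʳ 0ℚ)}
      (λ _ → refl) (λ _ → refl)
  ; 0-homo = ≈ʳ-refl {fromℚʳ 0ℚ} , ≈ʳ-refl {fromℚʳ 0ℚ}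
  ; 1-homo = ≈ʳ-refl {fromℚʳ 1ℚ} , ≈ʳ-refl {fromℚʳ 0ℚ}
  }

module ℂ-ring = CommutativeRing ℂ-commutativeRing

open Cubic ℂ-commutativeRing fromℚ-morphism

-- 4ρ³ + 3ρ = 1, (1 + υ)² = 3/2 and ν² = 3/4 (ρ² + 1)
ρ υ ν : ℝ
ρ = CubicRoot.limit
υ = SquareRoot.limit
ν = (fromℚʳ 1ℚ +ʳ υ) *ʳ (fromℚʳ ½ +ʳ (fromℚʳ ½ *ʳ ρ +ʳ ρ *ʳ ρ))

α : Fin 3 → ℂ
α zero             = ρ +i fromℚʳ 0ℚ
α (suc zero)       = (-ʳ (fromℚʳ ½ *ʳ ρ)) +i ν
α (suc (suc zero)) = (-ʳ (fromℚʳ ½ *ʳ ρ)) +i (-ʳ ν)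

private
  :c : ∀ {n} → ℕ → Polynomial n
  :c n = con (+ n / 1)

root₀ : IsRoot (α zero)
root₀ =
  null-cong (λ n → solve 1 (λ a →
      :- (:c 4 :* (a :* (a :* a)) :+ :c 3 :* a :- con 1ℚ)
      := re-cubic a :- con 0ℚ) refl (approx ρ n))
    (null-neg CubicRoot.residual-null) ,
  pointwise {im (cubic (α zero))} {fromℚʳ 0ℚ} (λ n → solve 1 (λ a → im-cubic a := con 0ℚ) refl (approx ρ n))
  where
  -- Real and imaginary parts are spelled out as complex multiplication unfolds them, zeros
  -- included, to match the goals syntactically for the solver.
  re-cubic im-cubic : ∀ {n} → Polynomial n → Polynomial n
  re₂ im₂ re₃ im₃ re₁ im₁ : ∀ {n} → Polynomial n → Polynomial n
  re₁ a = a :* :c 1 :- con 0ℚ :* con 0ℚ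
  im₁ a = a :* con 0ℚ :+ con 0ℚ :* :c 1
  re₂ a = a :* re₁ a :- con 0ℚ :* im₁ a
  im₂ a = a :* im₁ a :+ con 0ℚ :* re₁ a
  re₃ a = a :* re₂ a :- con 0ℚ :* im₂ a
  im₃ a = a :* im₂ a :+ con 0ℚ :* re₂ a
  re-cubic a = :c 1 :- (:c 3 :* a :- con 0ℚ :* con 0ℚ) :- (:c 4 :* re₃ a :- con 0ℚ :* im₃ a)
  im-cubic a = con 0ℚ :- (:c 3 :* con 0ℚ :+ con 0ℚ :* a) :- (:c 4 :* im₃ a :+ con 0ℚ :* re₃ a)

roots-sum : α zero + α (suc zero) + α (suc (suc zero)) ≈ fromℕ 0
roots-sum = pointwise-ℂ {α zero + α (suc zero) + α (suc (suc zero))} {fromℕ 0}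
  (λ n → solve 1 (λ a → a :+ :- (con ½ :* a) :+ :- (con ½ :* a) := con 0ℚ) refl (approx ρ n))
  (λ n → solve 1 (λ v → con 0ℚ :+ v :+ :- v := con 0ℚ) refl (approx ν n))

-- The real part asks for ν² = 3/4 (ρ² + 1). With ν = (1 + υ) ω the error is ω² ((1 + υ)² - 3/2)
-- plus 3/2 ω² - 3/4 (ρ² + 1), and the latter equals 3/8 (ρ + 1) (4ρ³ + 3ρ - 1). Both terms are
-- multiples of null residuals.
roots-product : α (suc zero) * α (suc (suc zero)) ≈ α zero * α zero + fromℚ (+ 3 / 4)
roots-product =
  null-cong (λ n → solve 2 (λ a u → let
        w = con ½ :+ (con ½ :* a :+ a :* a)
        v = (con 1ℚ :+ u) :* w
        h = :- (con ½ :* a) in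
      w :* w :* (u :* u :+ :c 2 :* u :- con ½)
        :+ con (+ 3 / 8) :* (a :+ con 1ℚ) :* (:c 4 :* (a :* (a :* a)) :+ :c 3 :* a :- con 1ℚ)
      := (h :* h :- v :* (:- v)) :- ((a :* a :- con 0ℚ :* con 0ℚ) :+ con (+ 3 / 4)))
      refl (approx ρ n) (approx υ n))
    (null-+ (null-* (ω *ʳ ω) SquareRoot.residual-null)
      (null-* (fromℚʳ (+ 3 / 8) *ʳ (ρ +ʳ fromℚʳ 1ℚ)) CubicRoot.residual-null)) ,
  pointwise {im (α (suc zero) * α (suc (suc zero)))} {im (α zero * α zero + fromℚ (+ 3 / 4))}
    (λ n → solve 2 (λ a v → let h = :- (con ½ :* a) in
      h :* (:- v) :+ v :* h := (a :* con 0ℚ :+ con 0ℚ :* a) :+ con 0ℚ) refl (approx ρ n) (approx ν n))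
  where ω = fromℚʳ ½ +ʳ (fromℚʳ ½ *ʳ ρ +ʳ ρ *ʳ ρ)

open ThreeRoots α root₀ roots-sum roots-product

-- Distinctness and completeness of the three roots

½≤ν : ∀ n → ½ ℚ.≤ approx ν n
½≤ν n = ≤-by (h ℚ.+ y ℚ.* (½ ℚ.+ h))
  (nonNeg-+ 0≤h (nonNeg-* 0≤y (nonNeg-+ 0≤½ 0≤h)))
  (solve 2 (λ y h → (con 1ℚ :+ y) :* (con ½ :+ h) := con ½ :+ (h :+ y :* (con ½ :+ h))) refl y h)
  where
  x = approx ρ n
  y = approx υ n
  h = ½ ℚ.* x ℚ.+ x ℚ.* x
  0≤½ = ℚ.nonNegative⁻¹ ½
  0≤x = proj₁ (CubicRoot.iterate-in n)
  0≤y = proj₁ (SquareRoot.iterate-in n)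
  0≤h = nonNeg-+ (nonNeg-* 0≤½ 0≤x) (nonNeg-* 0≤x 0≤x)

p≤∣p∣ : ∀ p → p ℚ.≤ ℚ.∣ p ∣
p≤∣p∣ p with ℚ.≤-total 0ℚ p
... | inj₁ 0≤p = ℚ.≤-reflexive (sym (ℚ.0≤p⇒∣p∣≡p 0≤p))
... | inj₂ p≤0 = ℚ.≤-trans p≤0 (ℚ.0≤∣p∣ p)

null⇒¬bounded-below : ∀ {b} → Null b → ¬ (∀ n → ½ ℚ.≤ b n)
null⇒¬bounded-below {b} null ½≤b with null ½ (ℚ.positive⁻¹ ½)
... | N , close = ℚ.<-irrefl refl (ℚ.≤-<-trans (ℚ.≤-trans (½≤b N) (p≤∣p∣ (b N))) (close N ℕ.≤-refl))

p≤q⇒0≤q-p : ∀ {p q} → p ℚ.≤ q → 0ℚ ℚ.≤ q ℚ.- p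
p≤q⇒0≤q-p {p} p≤q = ℚ.≤-trans (ℚ.≤-reflexive (sym (ℚ.+-inverseʳ p))) (ℚ.+-monoˡ-≤ (ℚ.- p) p≤q)

-- The bound is the square of 1/8, the gap that `locate` guarantees; squaring makes it independent
-- of the sign.
Apart : (ℕ → ℚ) → Set
Apart b = ∃[ N ] ∀ n → N ℕ.≤ n → (+ 1 / 64) ℚ.≤ b n ℚ.* b n

≥⇒square : ∀ {p} → (+ 1 / 8) ℚ.≤ p → (+ 1 / 64) ℚ.≤ p ℚ.* p
≥⇒square {p} 1/8≤p = ≤-by ((p ℚ.- (+ 1 / 8)) ℚ.* (p ℚ.- (+ 1 / 8) ℚ.+ (+ 1 / 4)))
  (nonNeg-* d (nonNeg-+ d (ℚ.nonNegative⁻¹ (+ 1 / 4))))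
  (solve 1 (λ p → p :* p := con (+ 1 / 64) :+ (p :- con (+ 1 / 8)) :* (p :- con (+ 1 / 8) :+ con (+ 1 / 4))) refl p)
  where d = p≤q⇒0≤q-p 1/8≤p

≤⇒square : ∀ {p} → p ℚ.≤ ℚ.- (+ 1 / 8) → (+ 1 / 64) ℚ.≤ p ℚ.* p
≤⇒square {p} p≤ = subst ((+ 1 / 64) ℚ.≤_) (solve 1 (λ p → :- p :* :- p := p :* p) refl p)
  (≥⇒square { ℚ.- p} (ℚ.neg-antimono-≤ p≤))

null-cancel : ∀ (b c : ℕ → ℚ) → Null (λ n → b n ℚ.* c n) → ∃[ N ] (∀ n → N ℕ.≤ n → (+ 1 / 64) ℚ.≤ b n) → Null c
null-cancel b c null (M , 1/64≤b) ε 0<ε with null ((+ 1 / 64) ℚ.* ε)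
  (subst (ℚ._< (+ 1 / 64) ℚ.* ε) (ℚ.*-zeroʳ (+ 1 / 64)) (ℚ.*-monoʳ-<-pos (+ 1 / 64) 0<ε))
... | N , close = M ℕ.⊔ N , λ n M⊔N≤n → ℚ.*-cancelˡ-<-nonNeg (+ 1 / 64) (begin-strict
    (+ 1 / 64) ℚ.* ℚ.∣ c n ∣
      ≤⟨ ℚ.*-monoʳ-≤-nonNeg ℚ.∣ c n ∣ {{ℚ.∣-∣-nonNeg (c n)}} (ℚ.≤-trans (1/64≤b n (ℕ.m⊔n≤o⇒m≤o M N M⊔N≤n)) (p≤∣p∣ (b n))) ⟩
    ℚ.∣ b n ∣ ℚ.* ℚ.∣ c n ∣
      ≡⟨ ℚ.∣p*q∣≡∣p∣*∣q∣ (b n) (c n) ⟨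
    ℚ.∣ b n ℚ.* c n ∣
      <⟨ close n (ℕ.m⊔n≤o⇒n≤o M N M⊔N≤n) ⟩
    (+ 1 / 64) ℚ.* ε ∎)
  where open ℚ.≤-Reasoning

-- Multiply by the conjugate of z to reduce to ∣z∣² w ≈ 0.
*-cancel-apart : ∀ z w → Apart (approx (im z)) → z * w ≈ fromℕ 0 → w ≈ fromℕ 0
*-cancel-apart (x +i y) (s +i t) (M , 1/64≤y²) (re≈0 , im≈0) =
  null-cancel ∣z∣² (λ n → approx s n ℚ.- 0ℚ) (null-cong (λ n → solve 4 (λ x y s t →
      x :* (x :* s :- y :* t :- con 0ℚ) :+ y :* (x :* t :+ y :* s :- con 0ℚ)
      := (x :* x :+ y :* y) :* (s :- con 0ℚ)) refl (approx x n) (approx y n) (approx s n) (approx t n))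
    (null-+ (null-* x re≈0) (null-* y im≈0))) ∣z∣²≥ ,
  null-cancel ∣z∣² (λ n → approx t n ℚ.- 0ℚ) (null-cong (λ n → solve 4 (λ x y s t →
      x :* (x :* t :+ y :* s :- con 0ℚ) :+ :- y :* (x :* s :- y :* t :- con 0ℚ)
      := (x :* x :+ y :* y) :* (t :- con 0ℚ)) refl (approx x n) (approx y n) (approx s n) (approx t n))
    (null-+ (null-* x im≈0) (null-* (-ʳ y) re≈0))) ∣z∣²≥
  where
  square-nonNeg : ∀ p → 0ℚ ℚ.≤ p ℚ.* p
  square-nonNeg p with ℚ.≤-total 0ℚ p
  ... | inj₁ 0≤p = nonNeg-* 0≤p 0≤p
  ... | inj₂ p≤0 = subst (0ℚ ℚ.≤_) (solve 1 (λ p → :- p :* :- p := p :* p) refl p)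
    (nonNeg-* (ℚ.neg-antimono-≤ p≤0) (ℚ.neg-antimono-≤ p≤0))
  ∣z∣² : ℕ → ℚ
  ∣z∣² n = approx x n ℚ.* approx x n ℚ.+ approx y n ℚ.* approx y n
  ∣z∣²≥ : ∃[ N ] (∀ n → N ℕ.≤ n → (+ 1 / 64) ℚ.≤ ∣z∣² n)
  ∣z∣²≥ = M , λ n M≤n → ℚ.≤-trans (ℚ.≤-reflexive (sym (ℚ.+-identityˡ (+ 1 / 64))))
    (ℚ.+-mono-≤ (square-nonNeg (approx x n)) (1/64≤y² n M≤n))

-- The three regions overlap, so one approximation within 1/8, compared with 1/4 and -1/4, is enough
-- to choose. Since ν ≥ 1/2, every region is at distance at least 1/8 from two of 0, ν and -ν.
data Position (y : ℝ) (N : ℕ) : Set where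
  above  : (∀ n → N ℕ.≤ n → (+ 1 / 8) ℚ.≤ approx y n) → Position y N
  below  : (∀ n → N ℕ.≤ n → approx y n ℚ.≤ ℚ.- (+ 1 / 8)) → Position y N
  middle : (∀ n → N ℕ.≤ n → ℚ.- (+ 3 / 8) ℚ.≤ approx y n × approx y n ℚ.≤ (+ 3 / 8)) → Position y N

locate : ∀ y → ∃ (Position y)
locate y with cauchy y (+ 1 / 8) (ℚ.positive⁻¹ _)
... | N , close = N , position
  where
  q = approx y N
  upper : ∀ n → N ℕ.≤ n → approx y n ℚ.≤ q ℚ.+ (+ 1 / 8)
  upper n N≤n = ≤-by ((+ 1 / 8) ℚ.- (approx y n ℚ.- q))
    (p≤q⇒0≤q-p (ℚ.≤-trans (p≤∣p∣ _) (ℚ.<⇒≤ (close n N N≤n ℕ.≤-refl))))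
    (solve 2 (λ y q → q :+ con (+ 1 / 8) := y :+ (con (+ 1 / 8) :- (y :- q))) refl (approx y n) q)
  lower : ∀ n → N ℕ.≤ n → q ℚ.- (+ 1 / 8) ℚ.≤ approx y n
  lower n N≤n = ≤-by ((+ 1 / 8) ℚ.- (q ℚ.- approx y n))
    (p≤q⇒0≤q-p (ℚ.≤-trans (p≤∣p∣ _) (ℚ.<⇒≤ (close N n ℕ.≤-refl N≤n))))
    (solve 2 (λ y q → y := q :- con (+ 1 / 8) :+ (con (+ 1 / 8) :- (q :- y))) refl (approx y n) q)
  position : Position y N
  position with ℚ.≤-total (+ 1 / 4) q
  ... | inj₁ 1/4≤q = above λ n N≤n → ℚ.≤-trans (ℚ.+-monoˡ-≤ (ℚ.- (+ 1 / 8)) 1/4≤q) (lower n N≤n)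
  ... | inj₂ q≤1/4 with ℚ.≤-total q (ℚ.- (+ 1 / 4))
  ...   | inj₁ q≤-1/4 = below λ n N≤n → ℚ.≤-trans (upper n N≤n) (ℚ.+-monoˡ-≤ (+ 1 / 8) q≤-1/4)
  ...   | inj₂ -1/4≤q = middle λ n N≤n →
    ℚ.≤-trans (ℚ.+-monoˡ-≤ (ℚ.- (+ 1 / 8)) -1/4≤q) (lower n N≤n) ,
    ℚ.≤-trans (upper n N≤n) (ℚ.+-monoˡ-≤ (+ 1 / 8) q≤1/4)

α-root : ∀ i → IsRoot (α i)
α-root zero             = root₀
α-root (suc zero)       = root₁
α-root (suc (suc zero)) = root₂

α₁≉α₀ : ¬ α (suc zero) ≈ α zero
α₁≉α₀ (_ , im≈) = null⇒¬bounded-below (null-cong (λ n → ℚ.+-identityʳ (approx ν n)) im≈) ½≤ν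

α₀≉α₂ : ¬ α zero ≈ α (suc (suc zero))
α₀≉α₂ (_ , im≈) = null⇒¬bounded-below
  (null-cong (λ n → solve 1 (λ v → con 0ℚ :- :- v := v) refl (approx ν n)) im≈) ½≤ν

α₁≉α₂ : ¬ α (suc zero) ≈ α (suc (suc zero))
α₁≉α₂ (_ , im≈) = null⇒¬bounded-below
  (null-cong (λ n → solve 1 (λ v → con ½ :* (v :- :- v) := v) refl (approx ν n)) (null-* (fromℚʳ ½) im≈)) ½≤ν

roots-injective : ∀ i j → α i ≈ α j → i ≡ j
roots-injective zero             zero             _ = refl
roots-injective zero             (suc zero)       e = ⊥-elim (α₁≉α₀ (ℂ-ring.sym {α zero} {α (suc zero)} e))
roots-injective zero             (suc (suc zero)) e = ⊥-elim (α₀≉α₂ e)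
roots-injective (suc zero)       zero             e = ⊥-elim (α₁≉α₀ e)
roots-injective (suc zero)       (suc zero)       _ = refl
roots-injective (suc zero)       (suc (suc zero)) e = ⊥-elim (α₁≉α₂ e)
roots-injective (suc (suc zero)) zero             e = ⊥-elim (α₀≉α₂ (ℂ-ring.sym {α (suc (suc zero))} {α zero} e))
roots-injective (suc (suc zero)) (suc zero)       e = ⊥-elim (α₁≉α₂ (ℂ-ring.sym {α (suc (suc zero))} {α (suc zero)} e))
roots-injective (suc (suc zero)) (suc (suc zero)) _ = refl

roots-exhaustive : ∀ z → IsRoot z → ∃[ i ] α i ≈ z
roots-exhaustive z z-root with locate (im z)
... | N , position = case-position position
  where
  0≤ν : ∀ n → 0ℚ ℚ.≤ approx ν n
  0≤ν n = ℚ.≤-trans (ℚ.nonNegative⁻¹ ½) (½≤ν n)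
  equal : ∀ i → z - α i ≈ fromℕ 0 → ∃[ i ] α i ≈ z
  equal i d≈0 = i , ℂ-ring.sym {z} {α i} (x-y≈0⇒x≈y {z} {α i} d≈0)
  d₀ = z - α zero
  d₁ = z - α (suc zero)
  d₂ = z - α (suc (suc zero))
  -- In each case the two factors whose imaginary parts are apart from 0 are cancelled one after the
  -- other, and the third is left to vanish.
  case-position : Position (im z) N → ∃[ i ] α i ≈ z
  case-position (above 1/8≤y) = equal (suc zero)
    (*-cancel-apart d₂ d₁
      (N , λ n N≤n → ≥⇒square (ℚ.≤-trans (1/8≤y n N≤n)
        (≤-by (approx ν n) (0≤ν n) (solve 2 (λ y v → y :- :- v := y :+ v) refl (approx (im z) n) (approx ν n)))))
      (*-cancel-apart d₀ (d₂ * d₁)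
        (N , λ n N≤n → ≥⇒square (ℚ.≤-trans (1/8≤y n N≤n) (ℚ.≤-reflexive (sym (ℚ.+-identityʳ _)))))
        (*-swap d₀ d₁ d₂ (factors {z} z-root))))
  case-position (below y≤-1/8) = equal (suc (suc zero))
    (*-cancel-apart d₁ d₂
      (N , λ n N≤n → ≤⇒square {approx (im d₁) n} (ℚ.≤-trans
        (≤-by (approx ν n) (0≤ν n) (solve 2 (λ y v → y := y :- v :+ v) refl (approx (im z) n) (approx ν n))) (y≤-1/8 n N≤n)))
      (*-cancel-apart d₀ (d₁ * d₂)
        (N , λ n N≤n → ≤⇒square (ℚ.≤-trans (ℚ.≤-reflexive (ℚ.+-identityʳ _)) (y≤-1/8 n N≤n)))
        (factors {z} z-root)))
  case-position (middle bounds) = equal zero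
    (*-cancel-apart d₂ d₀
      (N , λ n N≤n → ≥⇒square (ℚ.≤-trans (ℚ.+-mono-≤ (proj₁ (bounds n N≤n)) (½≤ν n))
        (ℚ.≤-reflexive (solve 2 (λ y v → y :+ v := y :- :- v) refl (approx (im z) n) (approx ν n)))))
      (*-cancel-apart d₁ (d₂ * d₀)
        (N , λ n N≤n → ≤⇒square (ℚ.+-mono-≤ (proj₂ (bounds n N≤n)) (ℚ.neg-antimono-≤ (½≤ν n))))
        (*-rotate d₀ d₁ d₂ (factors {z} z-root))))

root-enumeration : Enumeration 3 Root-setoid
root-enumeration = record
  { to        = λ i → α i , α-root i
  ; cong      = λ { {i} refl → ℂ-ring.refl {α i} }
  ; bijective = (λ {i} {j} → roots-injective i j) ,
      λ (z , z-root) → let i , i≈z = roots-exhaustive z z-root in i , λ { refl → i≈z }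
  }

-- The formula for the three complex roots

∑-suc : ∀ {m} (f : Fin (suc m) → ℂ) → ∑ f ≈ f zero + ∑ (λ i → f (suc i))
∑-suc f = pointwise-ℂ {∑ f} {f zero + ∑ (λ i → f (suc i))} (λ _ → refl) (λ _ → refl)

∑-zero : ∀ (f : Fin 0 → ℂ) → ∑ f ≈ # 0
∑-zero f = pointwise-ℂ {∑ f} {# 0} (λ _ → refl) (λ _ → refl)

∑-three : ∀ (f : Fin 3 → ℂ) → ∑ f ≈ f zero + (f (suc zero) + (f (suc (suc zero)) + # 0))
∑-three f = ℂ-ring.trans {∑ f} {f zero + ∑ f′} {f zero + (f (suc zero) + (f (suc (suc zero)) + # 0))} (∑-suc f)
  (ℂ-ring.+-congˡ {f zero} {∑ f′} {f (suc zero) + (f (suc (suc zero)) + # 0)}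
    (ℂ-ring.trans {∑ f′} {f (suc zero) + ∑ f″} {f (suc zero) + (f (suc (suc zero)) + # 0)} (∑-suc f′)
      (ℂ-ring.+-congˡ {f (suc zero)} {∑ f″} {f (suc (suc zero)) + # 0}
        (ℂ-ring.trans {∑ f″} {f (suc (suc zero)) + ∑ f‴} {f (suc (suc zero)) + # 0} (∑-suc f″)
          (ℂ-ring.+-congˡ {f (suc (suc zero))} {∑ f‴} {# 0} (∑-zero f‴))))))
  where
  f′ : Fin 2 → ℂ
  f′ i = f (suc i)
  f″ : Fin 1 → ℂ
  f″ i = f (suc (suc i))
  f‴ : Fin 0 → ℂ
  f‴ i = f (suc (suc (suc i)))

α⁻¹ : Fin 3 → ℂ
α⁻¹ i = inverse (α i)

α-inverse : ∀ i → α i * α⁻¹ i ≈ fromℕ 1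
α-inverse i = *-inverse {α i} (α-root i)

ℂ-root-formula : RootFormula _≈_ _+_ _-_ _*_ fromℚ fromℕ _^_ (∑ {3}) α⁻¹
ℂ-root-formula = root-formula _^_ (λ z → ℂ-ring.refl {z ^ 0}) (λ z n → ℂ-ring.refl {z ^ suc n})
  _-_ (λ z w → pointwise-ℂ {z - w} {ℂ-ring._-_ z w} (λ _ → refl) (λ _ → refl)) ∑ ∑-three

mainTheorem2 : Σ[ pds ∈ (ℕ → ℕ) ]
    (∀ n → Enumeration (pds n) (PDS-setoid n))
    × ((λ n → + pds n) ≗
    polynomial (+ 1 ∷ -[1+ 2 ] ∷ + 2 ∷ + 0 ∷ + 2 ∷ + 4 ∷ [])
    ⊘ (polynomial (+ 1 ∷ -[1+ 0 ] ∷ []) ⊛ polynomial (+ 1 ∷ -[1+ 2 ] ∷ + 0 ∷ -[1+ 3 ] ∷ [])))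
    × pds 0 ≡ 1
    × pds 1 ≡ 1
    × (Σ[ m ∈ ℕ ] Σ[ roots ∈ Enumeration m Root-setoid ] Σ[ inv ∈ (Fin m → ℂ) ]
    (∀ i → proj₁ (Bijection.to roots i) * inv i ≈ fromℕ 1)
    × (∀ n → 2 ≤ n →
    fromℕ (pds n) ≈
    fromℚ (+ 1 / 12) * ∑ (λ i → (inv i + fromℕ 1) * inv i ^ n) - fromℕ 1))
mainTheorem2 = pds , PDS-enumeration ,
  quotient-by-denominator (λ n → + pds n) refl refl refl refl refl refl pds-recurrence , refl , refl ,
  3 , root-enumeration , α⁻¹ , α-inverse ,
  -- A snake with n + 2 cells has n + 1 steps, so `freeCount` is taken at suc n while the exponent
  -- of the inverse roots is n + 2.
  λ { (suc (suc n)) (s≤s (s≤s _)) → RootFormula.formula ℂ-root-formula freeCount refl refl refl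
        freeCount-recurrence (suc n) (pds (suc (suc n))) (sym (length-canonicalWords n)) }
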